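{- Fix $r>0$ and $0<\sigma<\min(1,r^{ -1})$. The sequence $$B_k(\sigma,r)=\sigma^k\Lambda_{k+1}(r),\qquad k\ge1,$$ tends to zero as $k\to\infty$ and is (weakly) unimodal in $k$, i.e. nondecreasing up to some index and nonincreasing from then on. Its maximum is attained. The set of maximisers is an interval of integers, possibly a single point. As $\sigma$ varies in $(0,\min(1,r^{ -1}))$ with $r$ fixed, this set of maximisers can change only at values of $\sigma$ for which adjacent terms are equal, i.e. $B_k(\sigma,r)=B_{k+1}(\sigma,r)$ for some $k\ge1$ (it is constant on every subinterval containing no such value). The adjacent crossing values $$\sigma_k(r)=\frac{\Lambda_{k+1}(r)}{\Lambda_{k+2}(r)},\qquad k\ge1,$$ are nondecreasing in $k$. (Degeneracies are allowed: several adjacent equalities may occur at the same value of $\sigma$.)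
   Context: For $r>0$ and $h\ge1$, $A_h(r)$ is the $h\times h$ real symmetric tridiagonal matrix with zero diagonal and $(A_h(r))_{i,i+1}=(A_h(r))_{i+1,i}=r^{(i-1)/2}$ for $1\le i\le h-1$. $\lambda_h(r)$ denotes the spectral radius of $A_h(r)$, and $\Lambda_h(r)=\lambda_h(r)^2$. -}

module Defs where

open import Algebra.Core using (Op₁; Op₂)
open import Algebra.Bundles using (CommutativeRing; Semiring)
open import Algebra.Structures using (IsCommutativeRing)
import Algebra.Construct.NaturalChoice.Max as Max
import Algebra.Construct.NaturalChoice.Min as Min
import Algebra.Definitions.RawSemiring as RawSemiringDefs
open import Data.Bool.Base using (if_then_else_)
open import Data.Fin.Base using (Fin; toℕ)
open import Data.Nat.Base as ℕ using (ℕ; suc; _≡ᵇ_)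
open import Data.Product.Base using (∃; ∃₂; _×_; _,_)
open import Data.Vec.Functional using (Vector)
open import Function.Bundles using (_⇔_)
open import Level using (Lift; _⊔_) renaming (suc to lsuc)
open import Relation.Binary.Bundles using (TotalOrder)
open import Relation.Binary.Core using (Rel)
open import Relation.Binary.Structures using (IsTotalOrder)
import Relation.Binary.Construct.NonStrictToStrict as ToStrict
open import Relation.Nullary.Negation using (¬_)
open import Relation.Unary using (Pred)

-- The real numbers, axiomatised up to isomorphism as a (Dedekind-)complete
-- ordered field.  Inversion and supremum are total operations about which
-- nothing is assumed at 0#, respectively at sets that are empty or not
-- bounded above.

record CompleteOrderedField c ℓ₁ ℓ₂ : Set (lsuc (c ⊔ ℓ₁ ⊔ ℓ₂)) where
  infix  9 _⁻¹
  infix  8 -_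
  infixl 7 _*_
  infixl 6 _+_
  infix  4 _≈_ _≤_
  field
    Carrier           : Set c
    _≈_               : Rel Carrier ℓ₁
    _≤_               : Rel Carrier ℓ₂
    _+_               : Op₂ Carrier
    _*_               : Op₂ Carrier
    -_                : Op₁ Carrier
    _⁻¹               : Op₁ Carrier
    0#                : Carrier
    1#                : Carrier
    isCommutativeRing : IsCommutativeRing _≈_ _+_ _*_ -_ 0# 1#
    isTotalOrder      : IsTotalOrder _≈_ _≤_
    0≉1               : ¬ (0# ≈ 1#)
    *-inverseʳ        : ∀ {x} → ¬ (x ≈ 0#) → x * x ⁻¹ ≈ 1#
    +-monoˡ-≤         : ∀ z {x y} → x ≤ y → x + z ≤ y + z
    *-nonneg          : ∀ {x y} → 0# ≤ x → 0# ≤ y → 0# ≤ x * y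

  UpperBound : ∀ {p} → Pred Carrier p → Pred Carrier _
  UpperBound P u = ∀ {x} → P x → x ≤ u

  IsSupremum : ∀ {p} → Pred Carrier p → Pred Carrier _
  IsSupremum P s = UpperBound P s × (∀ {u} → UpperBound P u → s ≤ u)

  field
    sup            : Pred Carrier (c ⊔ ℓ₁ ⊔ ℓ₂) → Carrier
    sup-isSupremum : ∀ P → ∃ P → ∃ (UpperBound P) → IsSupremum P (sup P)

  commutativeRing : CommutativeRing c ℓ₁
  commutativeRing = record { isCommutativeRing = isCommutativeRing }

  totalOrder : TotalOrder c ℓ₁ ℓ₂
  totalOrder = record { isTotalOrder = isTotalOrder }

module Reals {c ℓ₁ ℓ₂} (ℝ : CompleteOrderedField c ℓ₁ ℓ₂) where

  open CompleteOrderedField ℝ public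
  open CommutativeRing commutativeRing public using (_-_; semiring)
  open RawSemiringDefs (Semiring.rawSemiring semiring) public using (_^_; sum)
  open ToStrict _≈_ _≤_ public using (_<_)
  open Min totalOrder public using (_⊓_)
  open Max totalOrder public renaming (_⊔_ to _⊔ᵣ_) using ()

  infixl 7 _÷_
  _÷_ : Op₂ Carrier
  x ÷ y = x * y ⁻¹

  ∣_∣ : Op₁ Carrier
  ∣ x ∣ = x ⊔ᵣ (- x)

  -- Meaningful for 0# ≤ x, where the set is nonempty and bounded above.
  √ : Op₁ Carrier
  √ x = sup λ y → Lift (c ⊔ ℓ₁ ⊔ ℓ₂) (y * y ≤ x)

  Matrix : ℕ → Set c
  Matrix n = Fin n → Fin n → Carrier

  infixr 7 _·ᵛ_
  _·ᵛ_ : ∀ {n} → Matrix n → Vector Carrier n → Vector Carrier n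
  (M ·ᵛ v) i = sum λ j → M i j * v j

  -- The complex number a + b i is an eigenvalue of the real matrix M, with
  -- complex eigenvector u + v i ; M (u + v i) = (a + b i) (u + v i) is
  -- written out in real and imaginary parts.
  IsEigenvalue : ∀ {n} → Matrix n → Carrier → Carrier → Set (c ⊔ ℓ₁)
  IsEigenvalue {n} M a b =
    ∃₂ λ (u v : Vector Carrier n) →
      (∃ λ i → ¬ (u i ≈ 0# × v i ≈ 0#)) ×
      (∀ i → (M ·ᵛ u) i ≈ a * u i - b * v i) ×
      (∀ i → (M ·ᵛ v) i ≈ b * u i + a * v i)

  -- The supremum of the moduli of all complex eigenvalues.
  spectralRadius : ∀ {n} → Matrix n → Carrier
  spectralRadius M = sup λ x → Lift (c ⊔ ℓ₁ ⊔ ℓ₂)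
    (∃₂ λ a b → IsEigenvalue M a b × x ≈ √ (a * a + b * b))

  -- Indices of Fin start at 0, so the entry r^((i-1)/2) in position (i , i+1)
  -- of the 1-based convention is (√ r) ^ toℕ i here.
  A : ∀ h → Carrier → Matrix h
  A h r i j =
    if      suc (toℕ i) ≡ᵇ toℕ j then √ r ^ toℕ i
    else if suc (toℕ j) ≡ᵇ toℕ i then √ r ^ toℕ j
    else 0#

  Λ : ℕ → Carrier → Carrier
  Λ h r = spectralRadius (A h r) ^ 2

  -- All sequences below are indexed by the integers k ≥ 1; their values at
  -- k = 0 are never used.

  B : ℕ → Carrier → Carrier → Carrier
  B k σ r = σ ^ k * Λ (k ℕ.+ 1) r

  crossing : ℕ → Carrier → Carrier
  crossing k r = Λ (k ℕ.+ 1) r ÷ Λ (k ℕ.+ 2) r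

  TendsToZero : (ℕ → Carrier) → Set _
  TendsToZero f = ∀ ε → 0# < ε → ∃ λ N → ∀ k → N ℕ.≤ k → ∣ f k ∣ < ε

  Unimodal : (ℕ → Carrier) → Set _
  Unimodal f = ∃ λ m → 1 ℕ.≤ m ×
    (∀ k → 1 ℕ.≤ k → k ℕ.< m → f k ≤ f (suc k)) ×
    (∀ k → m ℕ.≤ k → f (suc k) ≤ f k)

  IsMaximiser : (ℕ → Carrier) → ℕ → Set _
  IsMaximiser f k = 1 ℕ.≤ k × (∀ j → 1 ℕ.≤ j → f j ≤ f k)

  IsIntegerInterval : ∀ {p} → Pred ℕ p → Set _
  IsIntegerInterval P =
    ∃₂ λ a b → a ℕ.≤ b × (∀ k → P k ⇔ (a ℕ.≤ k × k ℕ.≤ b))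

  Admissible : Carrier → Pred Carrier _
  Admissible r σ = 0# < σ × σ < 1# ⊓ r ⁻¹

  HasAdjacentEquality : Carrier → Pred Carrier _
  HasAdjacentEquality r σ = ∃ λ k → 1 ℕ.≤ k × B k σ r ≈ B (suc k) σ r

  -- Order-convex sets of reals, i.e. intervals of any kind.
  IsInterval : ∀ {p} → Pred Carrier p → Set _
  IsInterval I = ∀ {x y z} → I x → I z → x ≤ y → y ≤ z → I y

{-# OPTIONS --safe #-}
-- Everything rests on the log-concavity of the Perron eigenvalues,
-- λ_h λ_{h+2} ≤ λ_{h+1}².  The subpaths 2 … h+1, 1 … h+2, 1 … h+1 and 2 … h+2
-- of the weighted path 1 … h+2 have Perron values s λ_h, λ_{h+2}, λ_{h+1} and
-- s λ_{h+1}, where s = √ r.  Two walks in the first two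
-- subpaths whose positions have equal parity can only cross by meeting, so the
-- maximum and the minimum of their positions are walks in the last two.  The
-- spectral form of this exchange tests the tensor product of the last two
-- Perron eigenvectors against a rearrangement about the diagonal of the tensor
-- product of the first two, restricted to x ≡ y (mod 2).
-- Log-concavity makes the ratios Λ_{k+1}/Λ_{k+2} nondecreasing, and these are
-- exactly the values σ at which adjacent terms of σ^k Λ_{k+1} agree.
module Submission where

open import Defs
open import Axiom.ExcludedMiddle using (ExcludedMiddle)
open import Algebra.Bundles using (CommutativeRing)
import Algebra.Construct.NaturalChoice.Max as MaxOperator
import Algebra.Construct.NaturalChoice.Min as MinOperator
import Algebra.Properties.AbelianGroup as AbelianGroupProperties
import Algebra.Properties.Ring as RingProperties
import Algebra.Properties.Semiring.Exp as Exponents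
import Algebra.Properties.Semiring.Mult.TCOptimised as Multiples
import Algebra.Properties.Semiring.Sum as Summation
import Algebra.Solver.Ring as RingSolver
open import Algebra.Solver.Ring.AlmostCommutativeRing using (fromCommutativeRing; _-Raw-AlmostCommutative⟶_)
open import Data.Bool.Base as Bool using (if_then_else_; true; false)
open import Data.Fin.Base using (toℕ; fromℕ<; inject₁)
import Data.Fin.Properties as Fin
open import Data.Integer.Base as ℤ using (ℤ; +_; -[1+_]; _⊖_; _◃_)
import Data.Integer.Properties as ℤ
open import Data.Maybe.Base as Maybe using (Maybe)
open import Data.Nat.Base as ℕ using (ℕ; zero; suc; z≤n; s≤s; _≡ᵇ_)
import Data.Nat.Properties as ℕ
open import Data.Product.Base using (∃; ∃₂; _×_; _,_; proj₁; proj₂)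
import Data.Sign.Base as Sign
open import Data.Sum.Base using (_⊎_; inj₁; inj₂; [_,_]′)
open import Data.Vec.Functional using (Vector)
open import Function.Base using (_∘_)
open import Function.Bundles using (_⇔_; mk⇔)
open import Level using (_⊔_; Lift; lift; lower)
open import Relation.Binary.Bundles using (TotalOrder)
import Relation.Binary.Construct.NonStrictToStrict as ToStrict
open import Relation.Binary.Definitions using (tri<; tri≈; tri>)
open import Relation.Binary.PropositionalEquality as ≡ using (_≡_)
import Relation.Binary.Reasoning.PartialOrder as PartialOrderReasoning
import Relation.Binary.Reasoning.Setoid as SetoidReasoning
open import Relation.Nullary.Decidable using (dec⇒maybe)
open import Relation.Nullary.Decidable.Core using (Dec; yes; no; map′; does)
open import Relation.Nullary.Negation using (¬_; contradiction)
open import Relation.Unary using (Pred; Decidable)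

-- A minimum of subsolutions need not be a subsolution, so above the diagonal the rearranged
-- function may violate the inequality wanted of it; only its sum with its transpose is safe. The
-- test function must therefore weigh each pair below the diagonal at least as much as its mirror
-- image. For the product z(x-1) z(y) this says that z(i-1)/z(i) is nondecreasing, i.e. that a
-- Perron vector is itself log-concave. Here the geometric weights enter: eliminating the eigenvalue
-- from two neighbouring rows gives a recursion for z(i)^2 - z(i-1) z(i+1) whose increments all have
-- the sign of 1 - s or all the opposite one, so nonnegativity can be read off at one end of the
-- path. The spectral radius is a supremum over complex eigenvalues, so Perron's theorem is needed
-- as well. A positive eigenvector comes from the largest root of recursively defined characteristic
-- polynomials, and a complex eigenvector is compared with it after entrywise division.

-- Ring solver with integer coefficients.

module IntegerSolver {a ℓ} (R : CommutativeRing a ℓ) where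

  open CommutativeRing R
  open RingProperties ring
  open AbelianGroupProperties +-abelianGroup using (⁻¹-∙-comm; ⁻¹-involutive; ε⁻¹≈ε)
  open Multiples semiring renaming (_×_ to _·_)
  open SetoidReasoning setoid

  ⟦_⟧ : ℤ → Carrier
  ⟦ + n ⟧      = n · 1#
  ⟦ -[1+ n ] ⟧ = - (suc n · 1#)

  ⟦⊖⟧ : ∀ m n → ⟦ m ⊖ n ⟧ ≈ m · 1# - n · 1#
  ⟦⊖⟧ m zero = sym (trans (+-congˡ ε⁻¹≈ε) (+-identityʳ _))
  ⟦⊖⟧ zero (suc n) = sym (+-identityˡ _)
  ⟦⊖⟧ (suc m) (suc n) = begin
    ⟦ suc m ⊖ suc n ⟧                        ≡⟨ ≡.cong ⟦_⟧ (ℤ.[1+m]⊖[1+n]≡m⊖n m n) ⟩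
    ⟦ m ⊖ n ⟧                                ≈⟨ ⟦⊖⟧ m n ⟩
    m · 1# - n · 1#                          ≈⟨ +-congʳ (+-identityʳ _) ⟨
    m · 1# + 0# - n · 1#                     ≈⟨ +-congʳ (+-congˡ (-‿inverseʳ 1#)) ⟨
    m · 1# + (1# - 1#) - n · 1#              ≈⟨ +-congʳ (+-assoc _ _ _) ⟨
    m · 1# + 1# - 1# - n · 1#                ≈⟨ +-assoc _ _ _ ⟩
    (m · 1# + 1#) + (- 1# - n · 1#)          ≈⟨ +-cong (+-comm _ _) (⁻¹-∙-comm _ _) ⟩
    1# + m · 1# - (1# + n · 1#)              ≈⟨ +-cong (1+× m 1#) (-‿cong (1+× n 1#)) ⟨
    suc m · 1# - suc n · 1#                  ∎

  ⟦+⟧ : ∀ i j → ⟦ i ℤ.+ j ⟧ ≈ ⟦ i ⟧ + ⟦ j ⟧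
  ⟦+⟧ (+ m)      (+ n)      = ×-homo-+ 1# m n
  ⟦+⟧ (+ m)      -[1+ n ]   = ⟦⊖⟧ m (suc n)
  ⟦+⟧ -[1+ m ]   (+ n)      = trans (⟦⊖⟧ n (suc m)) (+-comm _ _)
  ⟦+⟧ -[1+ m ]   -[1+ n ]   = begin
    - (suc (suc (m ℕ.+ n)) · 1#)      ≡⟨ ≡.cong (λ k → - (suc k · 1#)) (ℕ.+-suc m n) ⟨
    - ((suc m ℕ.+ suc n) · 1#)        ≈⟨ -‿cong (×-homo-+ 1# (suc m) (suc n)) ⟩
    - (suc m · 1# + suc n · 1#)       ≈⟨ ⁻¹-∙-comm _ _ ⟨
    - (suc m · 1#) - suc n · 1#       ∎

  ⟦-⟧ : ∀ i → ⟦ ℤ.- i ⟧ ≈ - ⟦ i ⟧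
  ⟦-⟧ (+ zero)  = sym ε⁻¹≈ε
  ⟦-⟧ (+ suc n) = refl
  ⟦-⟧ -[1+ n ]  = sym (⁻¹-involutive _)

  ⟦-◃⟧ : ∀ n → ⟦ Sign.- ◃ n ⟧ ≈ - (n · 1#)
  ⟦-◃⟧ zero    = sym ε⁻¹≈ε
  ⟦-◃⟧ (suc n) = refl

  ⟦+◃⟧ : ∀ n → ⟦ Sign.+ ◃ n ⟧ ≈ n · 1#
  ⟦+◃⟧ zero    = refl
  ⟦+◃⟧ (suc n) = refl

  ⟦*⟧ : ∀ i j → ⟦ i ℤ.* j ⟧ ≈ ⟦ i ⟧ * ⟦ j ⟧
  ⟦*⟧ (+ m)    (+ n)    = trans (⟦+◃⟧ (m ℕ.* n)) (×1-homo-* m n)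
  ⟦*⟧ (+ m)    -[1+ n ] = begin
    ⟦ Sign.- ◃ (m ℕ.* suc n) ⟧    ≈⟨ ⟦-◃⟧ (m ℕ.* suc n) ⟩
    - ((m ℕ.* suc n) · 1#)        ≈⟨ -‿cong (×1-homo-* m (suc n)) ⟩
    - (m · 1# * (suc n · 1#))     ≈⟨ -‿distribʳ-* _ _ ⟩
    m · 1# * - (suc n · 1#)       ∎
  ⟦*⟧ -[1+ m ] (+ n)    = begin
    ⟦ Sign.- ◃ (suc m ℕ.* n) ⟧    ≈⟨ ⟦-◃⟧ (suc m ℕ.* n) ⟩
    - ((suc m ℕ.* n) · 1#)        ≈⟨ -‿cong (×1-homo-* (suc m) n) ⟩
    - (suc m · 1# * (n · 1#))     ≈⟨ -‿distribˡ-* _ _ ⟩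
    - (suc m · 1#) * (n · 1#)     ∎
  ⟦*⟧ -[1+ m ] -[1+ n ] = begin
    (suc m ℕ.* suc n) · 1#                  ≈⟨ ×1-homo-* (suc m) (suc n) ⟩
    suc m · 1# * (suc n · 1#)               ≈⟨ ⁻¹-involutive _ ⟨
    - - (suc m · 1# * (suc n · 1#))         ≈⟨ -‿cong (-‿distribʳ-* _ _) ⟩
    - (suc m · 1# * - (suc n · 1#))         ≈⟨ -‿distribˡ-* _ _ ⟩
    - (suc m · 1#) * - (suc n · 1#)         ∎

  ⟦⟧-morphism : ℤ.+-*-rawRing -Raw-AlmostCommutative⟶ fromCommutativeRing R
  ⟦⟧-morphism = record
    { ⟦_⟧    = ⟦_⟧
    ; +-homo = ⟦+⟧
    ; *-homo = ⟦*⟧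
    ; -‿homo = ⟦-⟧
    ; 0-homo = refl
    ; 1-homo = refl
    }

  -- Terms cancel in the solver only when a coefficient is recognised as zero. For integers this
  -- test computes.
  _≟⟦⟧_ : ∀ i j → Maybe (⟦ i ⟧ ≈ ⟦ j ⟧)
  i ≟⟦⟧ j = Maybe.map (λ i≡j → reflexive (≡.cong ⟦_⟧ i≡j)) (dec⇒maybe (i ℤ.≟ j))

  open RingSolver ℤ.+-*-rawRing (fromCommutativeRing R) ⟦⟧-morphism _≟⟦⟧_
    public using (solve; _:=_; _:+_; _:*_; _:-_; :-_; con; Polynomial)

  :0 :1 : ∀ {n} → Polynomial n
  :0 = con (+ 0)
  :1 = con (+ 1)

module RealAnalysis {c ℓ₁ ℓ₂} (em : ExcludedMiddle (c ⊔ ℓ₁ ⊔ ℓ₂)) (ℝ : CompleteOrderedField c ℓ₁ ℓ₂) where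

  open Reals ℝ
  open CommutativeRing commutativeRing
    using (refl; sym; trans; reflexive; setoid; +-cong; +-congˡ; +-congʳ; *-cong; *-congˡ; *-congʳ; -‿cong;
           +-comm; *-comm; *-assoc; zeroˡ; zeroʳ; +-identityˡ; +-identityʳ; *-identityˡ; *-identityʳ)
  open IntegerSolver commutativeRing
    using (solve; _:=_; _:+_; _:*_; _:-_; :-_; :0; :1)
  open TotalOrder totalOrder using (poset; antisym; total; isPartialOrder; ≤-respˡ-≈; ≤-respʳ-≈)
    renaming (refl to ≤-refl; trans to ≤-trans; reflexive to ≤-reflexive)
  open MaxOperator totalOrder using (x≤x⊔y; x≤y⊔x; ⊔-sel; ⊔-idem)
  open MinOperator totalOrder using (⊓-glb; x⊓y≤x; x⊓y≤y; ⊓-sel)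
  open Exponents semiring using (^-congˡ)
  private module Sums = Summation semiring
  module ≤-Reasoning = PartialOrderReasoning poset

  -- Classical decidability and ordered-field arithmetic.

  infix 4 _≤?_ _≟_ _<?_
  _≤?_ : ∀ x y → Dec (x ≤ y)
  x ≤? y = map′ lower lift (em {Lift (c ⊔ ℓ₁ ⊔ ℓ₂) (x ≤ y)})

  _≟_ : ∀ x y → Dec (x ≈ y)
  x ≟ y = map′ lower lift (em {Lift (c ⊔ ℓ₁ ⊔ ℓ₂) (x ≈ y)})

  _<?_ : ∀ x y → Dec (x < y)
  _<?_ = ToStrict.<-decidable _≈_ _≤_ _≟_ _≤?_

  ≰⇒> : ∀ {x y} → ¬ (x ≤ y) → y < x
  ≰⇒> = ToStrict.≰⇒> _≈_ _≤_ sym ≤-reflexive total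

  ≮⇒≥ : ∀ {x y} → ¬ (x < y) → y ≤ x
  ≮⇒≥ = ToStrict.≮⇒≥ _≈_ _≤_ sym _≟_ ≤-reflexive total

  <⇒≱ : ∀ {x y} → x < y → ¬ (y ≤ x)
  <⇒≱ = ToStrict.<⇒≱ _≈_ _≤_ antisym

  <-irrefl : ∀ {x} → ¬ (x < x)
  <-irrefl = ToStrict.<-irrefl _≈_ _≤_ refl

  <⇒≤ : ∀ {x y} → x < y → x ≤ y
  <⇒≤ = proj₁

  <-trans : ∀ {x y z} → x < y → y < z → x < z
  <-trans = ToStrict.<-trans _≈_ _≤_ isPartialOrder

  <-≤-trans : ∀ {x y z} → x < y → y ≤ z → x < z
  <-≤-trans = ToStrict.<-≤-trans _≈_ _≤_ sym ≤-trans antisym ≤-respʳ-≈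

  ≤-<-trans : ∀ {x y z} → x ≤ y → y < z → x < z
  ≤-<-trans = ToStrict.≤-<-trans _≈_ _≤_ ≤-trans antisym ≤-respˡ-≈

  <-respʳ : ∀ {x y z} → y ≈ z → x < y → x < z
  <-respʳ y≈z x<y = <-≤-trans x<y (≤-reflexive y≈z)

  -- An inequality is proved by writing the difference of its sides as a
  -- visibly nonnegative expression, which the ring solver can check.
  ≤-by : ∀ {e x y} → 0# ≤ e → y - x ≈ e → x ≤ y
  ≤-by {e} {x} {y} 0≤e eq = begin
    x          ≈⟨ +-identityˡ x ⟨
    0# + x     ≤⟨ +-monoˡ-≤ x 0≤e ⟩
    e + x      ≈⟨ +-congʳ eq ⟨
    y - x + x  ≈⟨ solve 2 (λ x y → (y :- x :+ x) := y) refl x y ⟩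
    y          ∎
    where open ≤-Reasoning

  <-by : ∀ {e x y} → 0# < e → y - x ≈ e → x < y
  <-by {e} {x} {y} (0≤e , 0≉e) eq = ≤-by 0≤e eq , λ x≈y → 0≉e
    (trans (trans (solve 1 (λ x → :0 := (x :- x)) refl x) (+-congʳ x≈y)) eq)

  0≤y-x : ∀ {x y} → x ≤ y → 0# ≤ y - x
  0≤y-x {x} {y} x≤y = ≤-respˡ-≈ (solve 1 (λ x → (x :- x) := :0) refl x) (+-monoˡ-≤ (- x) x≤y)

  0<y-x : ∀ {x y} → x < y → 0# < y - x
  0<y-x {x} {y} (x≤y , x≉y) = 0≤y-x x≤y , λ 0≈y-x → x≉y
    (trans (sym (+-identityˡ x)) (trans (+-congʳ 0≈y-x) (solve 2 (λ x y → (y :- x :+ x) := y) refl x y)))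

  +-mono-≤ : ∀ {x y u v} → x ≤ y → u ≤ v → x + u ≤ y + v
  +-mono-≤ {x} {y} {u} {v} x≤y u≤v = begin
    x + u  ≤⟨ +-monoˡ-≤ u x≤y ⟩
    y + u  ≈⟨ +-comm y u ⟩
    u + y  ≤⟨ +-monoˡ-≤ y u≤v ⟩
    v + y  ≈⟨ +-comm v y ⟩
    y + v  ∎
    where open ≤-Reasoning

  +-nonneg : ∀ {x y} → 0# ≤ x → 0# ≤ y → 0# ≤ x + y
  +-nonneg 0≤x 0≤y = ≤-respˡ-≈ (+-identityˡ 0#) (+-mono-≤ 0≤x 0≤y)

  +-nonneg-pos : ∀ {x y} → 0# ≤ x → 0# < y → 0# < x + y
  +-nonneg-pos {x} {y} 0≤x 0<y = <-≤-trans 0<y (≤-by 0≤x (solve 2 (λ x y → (x :+ y :- y) := x) refl x y))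

  +-pos-nonneg : ∀ {x y} → 0# < x → 0# ≤ y → 0# < x + y
  +-pos-nonneg 0<x 0≤y = <-respʳ (+-comm _ _) (+-nonneg-pos 0≤y 0<x)

  *-monoˡ-≤ : ∀ {z x y} → 0# ≤ z → x ≤ y → z * x ≤ z * y
  *-monoˡ-≤ {z} {x} {y} 0≤z x≤y = ≤-by (*-nonneg 0≤z (0≤y-x x≤y))
    (solve 3 (λ z x y → (z :* y :- z :* x) := (z :* (y :- x))) refl z x y)

  *-monoʳ-≤ : ∀ {z x y} → 0# ≤ z → x ≤ y → x * z ≤ y * z
  *-monoʳ-≤ {z} {x} {y} 0≤z x≤y = ≤-by (*-nonneg 0≤z (0≤y-x x≤y))
    (solve 3 (λ z x y → (y :* z :- x :* z) := (z :* (y :- x))) refl z x y)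

  *-mono-≤ : ∀ {x y u v} → 0# ≤ x → 0# ≤ v → x ≤ y → u ≤ v → x * u ≤ y * v
  *-mono-≤ 0≤x 0≤v x≤y u≤v = ≤-trans (*-monoˡ-≤ 0≤x u≤v) (*-monoʳ-≤ 0≤v x≤y)

  pos⇒≉0 : ∀ {x} → 0# < x → ¬ (x ≈ 0#)
  pos⇒≉0 (_ , 0≉x) x≈0 = 0≉x (sym x≈0)

  *-inverseˡ : ∀ {x} → ¬ (x ≈ 0#) → x ⁻¹ * x ≈ 1#
  *-inverseˡ x≉0 = trans (*-comm _ _) (*-inverseʳ x≉0)

  *-pos : ∀ {x y} → 0# < x → 0# < y → 0# < x * y
  *-pos {x} {y} 0<x 0<y = *-nonneg (<⇒≤ 0<x) (<⇒≤ 0<y) , λ 0≈xy → proj₂ 0<y (begin-equality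
    0#              ≈⟨ zeroʳ _ ⟨
    x ⁻¹ * 0#       ≈⟨ *-congˡ 0≈xy ⟩
    x ⁻¹ * (x * y)  ≈⟨ *-assoc _ _ _ ⟨
    x ⁻¹ * x * y    ≈⟨ *-congʳ (*-inverseˡ (pos⇒≉0 0<x)) ⟩
    1# * y          ≈⟨ *-identityˡ y ⟩
    y               ∎)
    where open ≤-Reasoning

  ²-nonneg : ∀ x → 0# ≤ x * x
  ²-nonneg x with total 0# x
  ... | inj₁ 0≤x = *-nonneg 0≤x 0≤x
  ... | inj₂ x≤0 = ≤-respʳ-≈ (solve 1 (λ x → ((:0 :- x) :* (:0 :- x)) := (x :* x)) refl x)
                     (*-nonneg (0≤y-x x≤0) (0≤y-x x≤0))

  0<1 : 0# < 1#
  0<1 = ≤-respʳ-≈ (*-identityˡ 1#) (²-nonneg 1#) , 0≉1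

  *-cancelˡ-≤ : ∀ {z x y} → 0# < z → z * x ≤ z * y → x ≤ y
  *-cancelˡ-≤ {z} {x} {y} 0<z zx≤zy with x ≤? y
  ... | yes x≤y = x≤y
  ... | no  x≰y = contradiction zx≤zy (<⇒≱ (<-by (*-pos 0<z (0<y-x (≰⇒> x≰y)))
    (solve 3 (λ z x y → (z :* x :- z :* y) := (z :* (x :- y))) refl z x y)))

  *-cancelʳ-≤ : ∀ {z x y} → 0# < z → x * z ≤ y * z → x ≤ y
  *-cancelʳ-≤ 0<z xz≤yz =
    *-cancelˡ-≤ 0<z (≤-respˡ-≈ (*-comm _ _) (≤-respʳ-≈ (*-comm _ _) xz≤yz))

  *-monoˡ-< : ∀ {z x y} → 0# < z → x < y → z * x < z * y
  *-monoˡ-< {z} {x} {y} 0<z x<y = <-by (*-pos 0<z (0<y-x x<y))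
    (solve 3 (λ z x y → (z :* y :- z :* x) := (z :* (y :- x))) refl z x y)

  *-monoʳ-< : ∀ {z x y} → 0# < z → x < y → x * z < y * z
  *-monoʳ-< {z} {x} {y} 0<z x<y = <-by (*-pos 0<z (0<y-x x<y))
    (solve 3 (λ z x y → (y :* z :- x :* z) := (z :* (y :- x))) refl z x y)

  ⁻¹-pos : ∀ {x} → 0# < x → 0# < x ⁻¹
  ⁻¹-pos {x} 0<x with 0# <? x ⁻¹
  ... | yes 0<x⁻¹ = 0<x⁻¹
  ... | no  0≮x⁻¹ = contradiction
    (≤-respˡ-≈ (*-inverseʳ (pos⇒≉0 0<x)) (≤-respʳ-≈ (zeroʳ x) (*-monoˡ-≤ (<⇒≤ 0<x) (≮⇒≥ 0≮x⁻¹))))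
    (<⇒≱ 0<1)

  0≤x+x⇒0≤x : ∀ {x} → 0# ≤ x + x → 0# ≤ x
  0≤x+x⇒0≤x {x} 0≤x+x with total 0# x
  ... | inj₁ 0≤x = 0≤x
  ... | inj₂ x≤0 = ≤-trans 0≤x+x (≤-respʳ-≈ (+-identityʳ x) (+-mono-≤ ≤-refl x≤0))

  ²-pos : ∀ {x} → ¬ (x ≈ 0#) → 0# < x * x
  ²-pos {x} x≉0 with total 0# x
  ... | inj₁ 0≤x = *-pos (0≤x , λ 0≈x → x≉0 (sym 0≈x)) (0≤x , λ 0≈x → x≉0 (sym 0≈x))
  ... | inj₂ x≤0 = <-respʳ (solve 1 (λ x → ((:0 :- x) :* (:0 :- x)) := (x :* x)) refl x)
                     (*-pos (0<y-x (x≤0 , x≉0)) (0<y-x (x≤0 , x≉0)))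

  ²+²-pos : ∀ {x y} → ¬ (x ≈ 0# × y ≈ 0#) → 0# < x * x + y * y
  ²+²-pos {x} {y} xy≉0 with x ≟ 0#
  ... | no  x≉0 = +-pos-nonneg (²-pos x≉0) (²-nonneg y)
  ... | yes x≈0 = +-nonneg-pos (²-nonneg x) (²-pos (λ y≈0 → xy≉0 (x≈0 , y≈0)))

  ²-cancel-≤ : ∀ {x y} → 0# ≤ y → x * x ≤ y * y → x ≤ y
  ²-cancel-≤ {x} {y} 0≤y xx≤yy with x ≤? y
  ... | yes x≤y = x≤y
  ... | no  x≰y = contradiction xx≤yy (<⇒≱ (<-by
    (*-pos (0<y-x y<x) (+-pos-nonneg (≤-<-trans 0≤y y<x) 0≤y))
    (solve 2 (λ x y → (x :* x :- y :* y) := ((x :- y) :* (x :+ y))) refl x y)))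
    where y<x = ≰⇒> x≰y

  ²-cancel-≈ : ∀ {x y} → 0# ≤ x → 0# ≤ y → x * x ≈ y * y → x ≈ y
  ²-cancel-≈ 0≤x 0≤y xx≈yy = antisym (²-cancel-≤ 0≤y (≤-reflexive xx≈yy)) (²-cancel-≤ 0≤x (≤-reflexive (sym xx≈yy)))

  ^-nonneg : ∀ {x} → 0# ≤ x → ∀ n → 0# ≤ x ^ n
  ^-nonneg 0≤x zero    = <⇒≤ 0<1
  ^-nonneg 0≤x (suc n) = *-nonneg 0≤x (^-nonneg 0≤x n)

  ^-pos : ∀ {x} → 0# < x → ∀ n → 0# < x ^ n
  ^-pos 0<x zero    = 0<1
  ^-pos 0<x (suc n) = *-pos 0<x (^-pos 0<x n)

  ^-monoˡ-≤ : ∀ {x y} → 0# ≤ x → x ≤ y → ∀ n → x ^ n ≤ y ^ n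
  ^-monoˡ-≤ 0≤x x≤y zero    = ≤-refl
  ^-monoˡ-≤ 0≤x x≤y (suc n) = *-mono-≤ 0≤x (^-nonneg (≤-trans 0≤x x≤y) n) x≤y (^-monoˡ-≤ 0≤x x≤y n)

  ^-monoʳ-≤ : ∀ {x m n} → 1# ≤ x → m ℕ.≤ n → x ^ m ≤ x ^ n
  ^-monoʳ-≤ {x} {zero} {zero} 1≤x z≤n = ≤-refl
  ^-monoʳ-≤ {x} {zero} {suc n} 1≤x z≤n = ≤-respˡ-≈ (*-identityˡ 1#)
    (*-mono-≤ (<⇒≤ 0<1) (^-nonneg (≤-trans (<⇒≤ 0<1) 1≤x) n) 1≤x (^-monoʳ-≤ {x} {zero} {n} 1≤x z≤n))
  ^-monoʳ-≤ 1≤x (s≤s m≤n) = *-monoˡ-≤ (≤-trans (<⇒≤ 0<1) 1≤x) (^-monoʳ-≤ 1≤x m≤n)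

  ^-distrib-* : ∀ x y n → (x * y) ^ n ≈ x ^ n * y ^ n
  ^-distrib-* x y zero    = sym (*-identityˡ 1#)
  ^-distrib-* x y (suc n) = trans (*-congˡ (^-distrib-* x y n))
    (solve 4 (λ x y p q → (x :* y :* (p :* q)) := (x :* p :* (y :* q))) refl x y (x ^ n) (y ^ n))

  supremum-unique : ∀ {p} {P : Carrier → Set p} {s t} → IsSupremum P s → IsSupremum P t → s ≈ t
  supremum-unique (s-ub , s-lub) (t-ub , t-lub) = antisym (s-lub t-ub) (t-lub s-ub)

  -- Finite sums.

  -- Opaque, so that f can be inferred from ∑ n f.
  opaque
    ∑ : ℕ → (ℕ → Carrier) → Carrier
    ∑ n f = sum {n} (f ∘ toℕ)

    ∑-suc : ∀ n f → ∑ (suc n) f ≈ ∑ n f + f n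
    ∑-suc n f = trans (Sums.sum-init-last {n} (f ∘ toℕ)) (+-cong
      (reflexive (Sums.sum-cong-≗ {n} {λ i → f (toℕ (inject₁ i))} {λ i → f (toℕ i)} (λ i → ≡.cong f (Fin.toℕ-inject₁ i))))
      (reflexive (≡.cong f (Fin.toℕ-fromℕ n))))

    ∑-cong : ∀ n {f g} → (∀ i → i ℕ.< n → f i ≈ g i) → ∑ n f ≈ ∑ n g
    ∑-cong n f≈g = Sums.sum-cong-≋ (λ i → f≈g (toℕ i) (Fin.toℕ<n i))

    ∑-+ : ∀ n f g → ∑ n (λ i → f i + g i) ≈ ∑ n f + ∑ n g
    ∑-+ n f g = Sums.∑-distrib-+ {n} (f ∘ toℕ) (g ∘ toℕ)

    ∑-*ˡ : ∀ n x f → ∑ n (λ i → x * f i) ≈ x * ∑ n f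
    ∑-*ˡ n x f = sym (Sums.*-distribˡ-sum {n} x (f ∘ toℕ))

    ∑-comm : ∀ m n (F : ℕ → ℕ → Carrier) → ∑ m (λ i → ∑ n (F i)) ≈ ∑ n (λ j → ∑ m (λ i → F i j))
    ∑-comm m n F = Sums.∑-comm {m} {n} (λ i j → F (toℕ i) (toℕ j))

    ∑-mono-≤ : ∀ n {f g} → (∀ i → i ℕ.< n → f i ≤ g i) → ∑ n f ≤ ∑ n g
    ∑-mono-≤ zero    f≤g = ≤-refl
    ∑-mono-≤ (suc n) f≤g = +-mono-≤ (f≤g 0 (s≤s z≤n)) (∑-mono-≤ n (λ i i<n → f≤g (suc i) (s≤s i<n)))

    ∑-nonneg : ∀ n {f} → (∀ i → 0# ≤ f i) → 0# ≤ ∑ n f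
    ∑-nonneg zero    0≤f = ≤-refl
    ∑-nonneg (suc n) 0≤f = +-nonneg (0≤f 0) (∑-nonneg n (0≤f ∘ suc))

    ∑-pos : ∀ {n f} → (∀ i → 0# ≤ f i) → ∀ {i} → i ℕ.< n → 0# < f i → 0# < ∑ n f
    ∑-pos {suc n} 0≤f {zero}  _         0<f = +-pos-nonneg 0<f (∑-nonneg n (0≤f ∘ suc))
    ∑-pos {suc n} 0≤f {suc i} (s≤s i<n) 0<f = +-nonneg-pos (0≤f 0) (∑-pos (0≤f ∘ suc) i<n 0<f)

    ∑-zero : ∀ f → ∑ 0 f ≈ 0#
    ∑-zero f = refl

    ∑-one : ∀ f → ∑ 1 f ≈ f 0
    ∑-one f = +-identityʳ (f 0)

    ∑-front : ∀ n f → ∑ (suc n) f ≈ f 0 + ∑ n (f ∘ suc)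
    ∑-front n f = refl

    sum≈∑ : ∀ {n} {v : Vector Carrier n} f → (∀ i → v i ≈ f (toℕ i)) → sum v ≈ ∑ n f
    sum≈∑ {n} f v≈f = Sums.sum-cong-≋ v≈f

  ∑-0 : ∀ n → ∑ n (λ _ → 0#) ≈ 0#
  ∑-0 zero    = ∑-zero _
  ∑-0 (suc n) = trans (∑-suc n _) (trans (+-identityʳ _) (∑-0 n))

  -- The hypothesis covers an index outside the range, where nothing is selected. This occurs in the
  -- last row of the matrix, whose right neighbour is missing.
  ∑-select : ∀ n k (g : ℕ → Carrier) → (n ℕ.≤ k → g k ≈ 0#) → ∑ n (λ j → if k ≡ᵇ j then g j else 0#) ≈ g k
  ∑-select zero    k       g gk≈0 = trans (∑-zero _) (sym (gk≈0 z≤n))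
  ∑-select (suc n) zero    g gk≈0 = trans (∑-front n _) (trans (+-congˡ (∑-0 n)) (+-identityʳ _))
  ∑-select (suc n) (suc k) g gk≈0 = trans (∑-front n _) (trans (+-identityˡ _)
    (∑-select n k (g ∘ suc) (λ n≤k → gk≈0 (s≤s n≤k))))

  ∑∑ : ℕ → (ℕ → ℕ → Carrier) → Carrier
  ∑∑ n F = ∑ n (λ x → ∑ n (F x))

  ∑∑-cong : ∀ n {F G : ℕ → ℕ → Carrier} → (∀ x y → F x y ≈ G x y) → ∑∑ n F ≈ ∑∑ n G
  ∑∑-cong n F≈G = ∑-cong n (λ x _ → ∑-cong n (λ y _ → F≈G x y))

  ∑∑-+ : ∀ n F G → ∑∑ n (λ x y → F x y + G x y) ≈ ∑∑ n F + ∑∑ n G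
  ∑∑-+ n F G = trans (∑-cong n (λ x _ → ∑-+ n (F x) (G x))) (∑-+ n _ _)

  ∑∑-*ˡ : ∀ n z F → ∑∑ n (λ x y → z * F x y) ≈ z * ∑∑ n F
  ∑∑-*ˡ n z F = trans (∑-cong n (λ x _ → ∑-*ˡ n z (F x))) (∑-*ˡ n z _)

  -- Transposition does not change the double sum, so twice the sum is the sum of F + Fᵀ.
  ∑∑-nonneg-sym : ∀ n F → (∀ x y → 0# ≤ F x y + F y x) → 0# ≤ ∑∑ n F
  ∑∑-nonneg-sym n F 0≤F+Fᵀ = 0≤x+x⇒0≤x (≤-trans
    (∑-nonneg n (λ x → ∑-nonneg n (λ y → 0≤F+Fᵀ x y)))
    (≤-reflexive (trans (∑∑-+ n F (λ x y → F y x)) (+-congˡ (∑-comm n n (λ x y → F y x))))))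

  -- The weighted path operator and its tensor square.

  Adjacent : ℕ → ℕ → Set
  Adjacent i j = j ≡ suc i ⊎ i ≡ suc j

  -- The weighted adjacency operator of the one-sided infinite path, with
  -- weight a i on the edge between i and i + 1.
  module Path (a : ℕ → Carrier) (0≤a : ∀ i → 0# ≤ a i) where

    op : (ℕ → Carrier) → ℕ → Carrier
    op f zero    = a 0 * f 1
    op f (suc i) = a (suc i) * f (2 ℕ.+ i) + a i * f i

    op-mono : ∀ {f g} i → (∀ {j} → Adjacent i j → f j ≤ g j) → op f i ≤ op g i
    op-mono zero    f≤g = *-monoˡ-≤ (0≤a 0) (f≤g (inj₁ ≡.refl))
    op-mono (suc i) f≤g = +-mono-≤ (*-monoˡ-≤ (0≤a (suc i)) (f≤g (inj₁ ≡.refl)))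
                                   (*-monoˡ-≤ (0≤a i) (f≤g (inj₂ ≡.refl)))

    op-cong : ∀ {f g} → (∀ j → f j ≈ g j) → ∀ i → op f i ≈ op g i
    op-cong f≈g zero    = *-congˡ (f≈g 1)
    op-cong f≈g (suc i) = +-cong (*-congˡ (f≈g (2 ℕ.+ i))) (*-congˡ (f≈g i))

    op-nonneg : ∀ {f} → (∀ j → 0# ≤ f j) → ∀ i → 0# ≤ op f i
    op-nonneg 0≤f zero    = *-nonneg (0≤a 0) (0≤f 1)
    op-nonneg 0≤f (suc i) = +-nonneg (*-nonneg (0≤a (suc i)) (0≤f (2 ℕ.+ i))) (*-nonneg (0≤a i) (0≤f i))

    op-zero : ∀ {f} → (∀ j → f j ≈ 0#) → ∀ i → op f i ≈ 0#
    op-zero f≈0 zero    = trans (*-congˡ (f≈0 1)) (zeroʳ _)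
    op-zero f≈0 (suc i) = trans (+-cong (trans (*-congˡ (f≈0 (2 ℕ.+ i))) (zeroʳ _)) (trans (*-congˡ (f≈0 i)) (zeroʳ _))) (+-identityˡ 0#)

    op-+ : ∀ f g i → op (λ j → f j + g j) i ≈ op f i + op g i
    op-+ f g zero    = solve 3 (λ a x y → (a :* (x :+ y)) := (a :* x :+ a :* y)) refl (a 0) (f 1) (g 1)
    op-+ f g (suc i) = solve 6 (λ a b x y u v →
      (a :* (x :+ y) :+ b :* (u :+ v)) := (a :* x :+ b :* u :+ (a :* y :+ b :* v))) refl
      (a (suc i)) (a i) (f (2 ℕ.+ i)) (g (2 ℕ.+ i)) (f i) (g i)

    op-*ˡ : ∀ x f i → op (λ j → x * f j) i ≈ x * op f i
    op-*ˡ x f zero    = solve 3 (λ a x f → (a :* (x :* f)) := (x :* (a :* f))) refl (a 0) x (f 1)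
    op-*ˡ x f (suc i) = solve 5 (λ a b x f g → (a :* (x :* f) :+ b :* (x :* g)) := (x :* (a :* f :+ b :* g))) refl
      (a (suc i)) (a i) x (f (2 ℕ.+ i)) (f i)

    op-*ʳ : ∀ x f i → op (λ j → f j * x) i ≈ op f i * x
    op-*ʳ x f i = trans (op-cong (λ _ → *-comm _ _) i) (trans (op-*ˡ x f i) (*-comm _ _))

    op-comm : ∀ (F : ℕ → ℕ → Carrier) i j → op (λ x → op (F x) j) i ≈ op (λ y → op (λ x → F x y) i) j
    op-comm F zero    j = sym (op-*ˡ (a 0) (F 1) j)
    op-comm F (suc i) j = sym (trans (op-+ _ _ j)
      (+-cong (op-*ˡ (a (suc i)) (F (2 ℕ.+ i)) j) (op-*ˡ (a i) (F i) j)))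

    -- A discrete Green identity. Edges inside 0 ... n contribute equally to both sums; only the
    -- edge from n to n + 1 leaves boundary terms, one on each side to avoid subtraction.
    ∑-op-boundary : ∀ n f g →
      ∑ (suc n) (λ i → op f i * g i) + a n * f n * g (suc n) ≈
      ∑ (suc n) (λ i → f i * op g i) + a n * f (suc n) * g n
    ∑-op-boundary zero f g = trans (+-congʳ (∑-one _)) (trans
      (solve 5 (λ a f₀ f₁ g₀ g₁ →
        (a :* f₁ :* g₀ :+ a :* f₀ :* g₁) := (f₀ :* (a :* g₁) :+ a :* f₁ :* g₀)) refl
        (a 0) (f 0) (f 1) (g 0) (g 1))
      (+-congʳ (sym (∑-one _))))
    ∑-op-boundary (suc n) f g = begin-equality
      ∑ (2 ℕ.+ n) (λ i → op f i * g i) + β * f₁ * g₂      ≈⟨ +-congʳ (∑-suc (suc n) _) ⟩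
      S + (β * f₂ + α * f₀) * g₁ + β * f₁ * g₂            ≈⟨ solve 8 (λ s f₀ f₁ f₂ g₁ g₂ α β →
        (s :+ (β :* f₂ :+ α :* f₀) :* g₁ :+ β :* f₁ :* g₂) :=
        ((s :+ α :* f₀ :* g₁) :+ (β :* f₂ :* g₁ :+ β :* f₁ :* g₂))) refl S f₀ f₁ f₂ g₁ g₂ α β ⟩
      (S + α * f₀ * g₁) + (β * f₂ * g₁ + β * f₁ * g₂)     ≈⟨ +-congʳ (∑-op-boundary n f g) ⟩
      (T + α * f₁ * g₀) + (β * f₂ * g₁ + β * f₁ * g₂)     ≈⟨ solve 8 (λ t f₁ f₂ g₀ g₁ g₂ α β →
        ((t :+ α :* f₁ :* g₀) :+ (β :* f₂ :* g₁ :+ β :* f₁ :* g₂)) :=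
        (t :+ f₁ :* (β :* g₂ :+ α :* g₀) :+ β :* f₂ :* g₁)) refl T f₁ f₂ g₀ g₁ g₂ α β ⟩
      T + f₁ * (β * g₂ + α * g₀) + β * f₂ * g₁            ≈⟨ +-congʳ (∑-suc (suc n) _) ⟨
      ∑ (2 ℕ.+ n) (λ i → f i * op g i) + β * f₂ * g₁      ∎
      where
      open ≤-Reasoning
      f₀ = f n
      f₁ = f (suc n)
      f₂ = f (2 ℕ.+ n)
      g₀ = g n
      g₁ = g (suc n)
      g₂ = g (2 ℕ.+ n)
      α = a n
      β = a (suc n)
      S = ∑ (suc n) (λ i → op f i * g i)
      T = ∑ (suc n) (λ i → f i * op g i)

    op-symmetric : ∀ n f g → f n ≈ 0# → g n ≈ 0# →
      ∑ n (λ i → op f i * g i) ≈ ∑ n (λ i → f i * op g i)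
    op-symmetric zero    f g fn≈0 gn≈0 = trans (∑-zero _) (sym (∑-zero _))
    op-symmetric (suc n) f g fn≈0 gn≈0 = begin-equality
      ∑ (suc n) (λ i → op f i * g i)                              ≈⟨ +-identityʳ _ ⟨
      ∑ (suc n) (λ i → op f i * g i) + 0#                         ≈⟨ +-congˡ (trans (*-congˡ gn≈0) (zeroʳ _)) ⟨
      ∑ (suc n) (λ i → op f i * g i) + a n * f n * g (suc n)      ≈⟨ ∑-op-boundary n f g ⟩
      ∑ (suc n) (λ i → f i * op g i) + a n * f (suc n) * g n      ≈⟨ +-congˡ (*-congʳ (trans (*-congˡ fn≈0) (zeroʳ _))) ⟩
      ∑ (suc n) (λ i → f i * op g i) + 0# * g n                   ≈⟨ +-congˡ (zeroˡ _) ⟩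
      ∑ (suc n) (λ i → f i * op g i) + 0#                         ≈⟨ +-identityʳ _ ⟩
      ∑ (suc n) (λ i → f i * op g i)                              ∎
      where open ≤-Reasoning

    -- The transfer operator of two walkers that step simultaneously; hence the parity of x + y is
    -- preserved.
    op₂ : (ℕ → ℕ → Carrier) → ℕ → ℕ → Carrier
    op₂ F x y = op (λ x′ → op (F x′) y) x

    op₂-mono : ∀ {F G} x y → (∀ {x′ y′} → Adjacent x x′ → Adjacent y y′ → F x′ y′ ≤ G x′ y′) →
               op₂ F x y ≤ op₂ G x y
    op₂-mono x y F≤G = op-mono x (λ x~x′ → op-mono y (λ y~y′ → F≤G x~x′ y~y′))

    op₂-cong : ∀ {F G} → (∀ x y → F x y ≈ G x y) → ∀ x y → op₂ F x y ≈ op₂ G x y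
    op₂-cong F≈G x y = op-cong (λ x′ → op-cong (F≈G x′) y) x

    op₂-+ : ∀ F G x y → op₂ (λ x′ y′ → F x′ y′ + G x′ y′) x y ≈ op₂ F x y + op₂ G x y
    op₂-+ F G x y = trans (op-cong (λ x′ → op-+ (F x′) (G x′) y) x) (op-+ _ _ x)

    op₂-⊗ : ∀ f g x y → op₂ (λ x′ y′ → f x′ * g y′) x y ≈ op f x * op g y
    op₂-⊗ f g x y = trans (op-cong (λ x′ → op-*ˡ (f x′) g y) x) (op-*ʳ (op g y) f x)

    -- The operator is moved across in one variable at a time, with the sums exchanged in between.
    -- The two copies end up nested the other way round, and `op-comm` swaps them back.
    op₂-symmetric : ∀ n F G →
      (∀ y → F n y ≈ 0#) → (∀ x → F x n ≈ 0#) → (∀ y → G n y ≈ 0#) → (∀ x → G x n ≈ 0#) →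
      ∑∑ n (λ x y → op₂ F x y * G x y) ≈ ∑∑ n (λ x y → F x y * op₂ G x y)
    op₂-symmetric n F G Fny≈0 Fxn≈0 Gny≈0 Gxn≈0 = begin-equality
      ∑ n (λ x → ∑ n λ y → op (λ x′ → op (F x′) y) x * G x y)
        ≈⟨ ∑-comm n n _ ⟩
      ∑ n (λ y → ∑ n λ x → op (λ x′ → op (F x′) y) x * G x y)
        ≈⟨ ∑-cong n (λ y _ → op-symmetric n (λ x → op (F x) y) (λ x → G x y) (op-zero Fny≈0 y) (Gny≈0 y)) ⟩
      ∑ n (λ y → ∑ n λ x → op (F x) y * op (λ x′ → G x′ y) x)
        ≈⟨ ∑-comm n n _ ⟩
      ∑ n (λ x → ∑ n λ y → op (F x) y * op (λ x′ → G x′ y) x)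
        ≈⟨ ∑-cong n (λ x _ → op-symmetric n (F x) _ (Fxn≈0 x) (op-zero Gxn≈0 x)) ⟩
      ∑ n (λ x → ∑ n λ y → F x y * op (λ y′ → op (λ x′ → G x′ y′) x) y)
        ≈⟨ ∑-cong n (λ x _ → ∑-cong n (λ y _ → *-congˡ (sym (op-comm G x y)))) ⟩
      ∑ n (λ x → ∑ n λ y → F x y * op₂ G x y)
        ∎
      where open ≤-Reasoning

  -- Rearrangement about the diagonal.

  -- The counterpart for functions of replacing two walkers by the maximum and the minimum of their
  -- positions: the larger value moves to the side where the first coordinate is larger.
  rearrange : (ℕ → ℕ → Carrier) → ℕ → ℕ → Carrier
  rearrange U x y = if does (y ℕ.≤? x) then U x y ⊔ᵣ U y x else U x y ⊓ U y x

  rearrange-≤ : ∀ U {x y} → y ℕ.≤ x → rearrange U x y ≡ U x y ⊔ᵣ U y x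
  -- The decision procedure computes through the Boolean test, so matching on that test unfolds the
  -- conditional.
  rearrange-≤ U {x} {y} y≤x with y ℕ.≤ᵇ x | ℕ.≤⇒≤ᵇ y≤x
  ... | true | _ = ≡.refl

  rearrange-> : ∀ U {x y} → x ℕ.< y → rearrange U x y ≡ U x y ⊓ U y x
  rearrange-> U {x} {y} x<y with y ℕ.≤ᵇ x | ℕ.≤ᵇ⇒≤ y x
  ... | false | _   = ≡.refl
  ... | true  | y≤x = contradiction (y≤x _) (ℕ.<⇒≱ x<y)

  -- With the arguments of the minimum swapped, the single comparison `total y x` decides both
  -- operations.
  ⊔+⊓ : ∀ x y → (x ⊔ᵣ y) + (y ⊓ x) ≈ x + y
  ⊔+⊓ x y with total y x
  ... | inj₁ _ = refl
  ... | inj₂ _ = +-comm y x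

  rearrange-nonneg : ∀ {U} → (∀ x y → 0# ≤ U x y) → ∀ x y → 0# ≤ rearrange U x y
  rearrange-nonneg {U} 0≤U x y with ℕ.≤-<-connex y x
  ... | inj₁ y≤x rewrite rearrange-≤ U y≤x = ≤-trans (0≤U x y) (x≤x⊔y _ _)
  ... | inj₂ x<y rewrite rearrange-> U x<y = ⊓-glb (0≤U x y) (0≤U y x)

  -- Each transposed pair of values is merely sorted, which preserves its sum.
  rearrange-sym : ∀ U x y → rearrange U x y + rearrange U y x ≈ U x y + U y x
  rearrange-sym U x y with ℕ.<-cmp x y
  ... | tri< x<y _ _ rewrite rearrange-> U x<y | rearrange-≤ U (ℕ.<⇒≤ x<y) =
        trans (+-comm _ _) (trans (⊔+⊓ (U y x) (U x y)) (+-comm _ _))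
  ... | tri≈ _ ≡.refl _ rewrite rearrange-≤ U (ℕ.≤-refl {x}) = +-cong (⊔-idem _) (⊔-idem _)
  ... | tri> _ _ y<x rewrite rearrange-> U y<x | rearrange-≤ U (ℕ.<⇒≤ y<x) = ⊔+⊓ (U x y) (U y x)

  -- The difference x - y starts at 1 or more and changes by 0 or 2 in either direction, so it ends
  -- at -1 or more. The value -1 is the swap of two neighbours, which the parity restriction will
  -- rule out.
  adjacent-order : ∀ {x y x′ y′} → y ℕ.< x → Adjacent x x′ → Adjacent y y′ → y′ ℕ.≤ x′ ⊎ y′ ≡ suc x′
  adjacent-order y<x (inj₁ ≡.refl) (inj₁ ≡.refl) = inj₁ (ℕ.m≤n⇒m≤1+n y<x)
  adjacent-order y<x (inj₁ ≡.refl) (inj₂ ≡.refl) = inj₁ (ℕ.≤-trans (ℕ.n≤1+n _) (ℕ.≤-trans (ℕ.<⇒≤ y<x) (ℕ.n≤1+n _)))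
  adjacent-order (s≤s y≤x′) (inj₂ ≡.refl) (inj₁ ≡.refl) with ℕ.m≤n⇒m<n∨m≡n y≤x′
  ... | inj₁ y<x′   = inj₁ y<x′
  ... | inj₂ ≡.refl = inj₂ ≡.refl
  adjacent-order (s≤s y≤x′) (inj₂ ≡.refl) (inj₂ ≡.refl) = inj₁ (ℕ.≤-trans (ℕ.n≤1+n _) y≤x′)

  module _ (a : ℕ → Carrier) (0≤a : ∀ i → 0# ≤ a i) where
    open Path a 0≤a

    -- V = rearrange U moves the mass of U below the diagonal, where Ω is
    -- larger.  Below the diagonal V is a maximum of subsolutions, hence a
    -- subsolution; above it the defect e may be negative, but e + eᵀ ≥ 0.
    module _ {U : ℕ → ℕ → Carrier} {κ : Carrier} (0≤U : ∀ x y → 0# ≤ U x y)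
             (U↑ : ∀ x → U x (suc x) ≈ 0#) (U↓ : ∀ x → U (suc x) x ≈ 0#)
             (subsolution : ∀ x y → κ * U x y ≤ op₂ U x y) where
      private
        V e : ℕ → ℕ → Carrier
        V = rearrange U
        e x y = op₂ V x y - κ * V x y

        -- These are the places that one step from below the diagonal can reach. On y ≤ x the
        -- maximum dominates; just above the diagonal both values of `U` vanish.
        near-diagonal : ∀ {x y} → y ℕ.≤ x ⊎ y ≡ suc x → U x y ≤ V x y × U y x ≤ V x y
        near-diagonal (inj₁ y≤x) rewrite rearrange-≤ U y≤x = x≤x⊔y _ _ , x≤y⊔x _ _
        near-diagonal {x} (inj₂ ≡.refl) =
          ≤-respˡ-≈ (sym (U↑ x)) (rearrange-nonneg 0≤U _ _) , ≤-respˡ-≈ (sym (U↓ x)) (rearrange-nonneg 0≤U _ _)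

        e-nonneg : ∀ {x y} → y ℕ.< x → 0# ≤ e x y
        e-nonneg {x} {y} y<x = 0≤y-x κV≤
          where
          U≤ : κ * U x y ≤ op₂ V x y
          U≤ = ≤-trans (subsolution x y)
            (op₂-mono x y (λ x~ y~ → proj₁ (near-diagonal (adjacent-order y<x x~ y~))))
          -- The transpose of `U` is a subsolution too, because `op₂` commutes with transposition.
          Uᵀ≤ : κ * U y x ≤ op₂ V x y
          Uᵀ≤ = ≤-trans (subsolution y x) (≤-respˡ-≈ (op-comm (λ x′ y′ → U y′ x′) x y)
            (op₂-mono x y (λ x~ y~ → proj₂ (near-diagonal (adjacent-order y<x x~ y~)))))
          κV≤ : κ * V x y ≤ op₂ V x y
          κV≤ rewrite rearrange-≤ U (ℕ.<⇒≤ y<x) with ⊔-sel (U x y) (U y x)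
          ... | inj₁ ⊔≈ = ≤-respˡ-≈ (*-congˡ (sym ⊔≈)) U≤
          ... | inj₂ ⊔≈ = ≤-respˡ-≈ (*-congˡ (sym ⊔≈)) Uᵀ≤

        op₂V-sym : ∀ x y → op₂ V x y + op₂ V y x ≈ op₂ U x y + op₂ U y x
        op₂V-sym x y = begin-equality
          op₂ V x y + op₂ V y x                     ≈⟨ +-congˡ (op-comm V y x) ⟩
          op₂ V x y + op₂ (λ x y → V y x) x y       ≈⟨ op₂-+ V (λ x y → V y x) x y ⟨
          op₂ (λ x y → V x y + V y x) x y           ≈⟨ op₂-cong (rearrange-sym U) x y ⟩
          op₂ (λ x y → U x y + U y x) x y           ≈⟨ op₂-+ U (λ x y → U y x) x y ⟩
          op₂ U x y + op₂ (λ x y → U y x) x y       ≈⟨ +-congˡ (op-comm U y x) ⟨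
          op₂ U x y + op₂ U y x                     ∎
          where open ≤-Reasoning

        -- The symmetrised defect depends on `V` only through V + Vᵀ = U + Uᵀ, so it is the sum of
        -- two defects of `U`.
        e-sym : ∀ x y → 0# ≤ e x y + e y x
        e-sym x y = ≤-respʳ-≈ (begin-equality
          (op₂ U x y - κ * U x y) + (op₂ U y x - κ * U y x)
            ≈⟨ solve 5 (λ p q κ u v → ((p :- κ :* u) :+ (q :- κ :* v)) := ((p :+ q) :- κ :* (u :+ v))) refl _ _ κ _ _ ⟩
          (op₂ U x y + op₂ U y x) - κ * (U x y + U y x)
            ≈⟨ +-cong (op₂V-sym x y) (-‿cong (*-congˡ (rearrange-sym U x y))) ⟨
          (op₂ V x y + op₂ V y x) - κ * (V x y + V y x)
            ≈⟨ solve 5 (λ p q κ u v → ((p :- κ :* u) :+ (q :- κ :* v)) := ((p :+ q) :- κ :* (u :+ v))) refl _ _ κ _ _ ⟨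
          e x y + e y x
            ∎)
          (+-nonneg (0≤y-x (subsolution x y)) (0≤y-x (subsolution y x)))
          where open ≤-Reasoning

      -- The difference of the sides is the sum of e Ω. For y < x, with primes for the mirror image,
      -- e Ω + e′ Ω′ = e (Ω - Ω′) + (e + e′) Ω′, and all four factors on the right are nonnegative.
      rearrangement : ∀ {Ω : ℕ → ℕ → Carrier} → (∀ x y → 0# ≤ Ω x y) → (∀ {x y} → y ℕ.< x → Ω y x ≤ Ω x y) → ∀ n →
        κ * ∑∑ n (λ x y → V x y * Ω x y) ≤ ∑∑ n (λ x y → op₂ V x y * Ω x y)
      rearrangement {Ω} 0≤Ω Ω-mono n = ≤-by
        (∑∑-nonneg-sym n (λ x y → e x y * Ω x y) eΩ-sym)
        (begin-equality
          ∑∑ n (λ x y → op₂ V x y * Ω x y) - κ * ∑∑ n (λ x y → V x y * Ω x y)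
            ≈⟨ +-congʳ (∑∑-cong n (λ x y → solve 4
                 (λ p κ v ω → (p :* ω) := ((p :- κ :* v) :* ω :+ κ :* (v :* ω))) refl (op₂ V x y) κ (V x y) (Ω x y))) ⟩
          ∑∑ n (λ x y → e x y * Ω x y + κ * (V x y * Ω x y)) - κ * ∑∑ n (λ x y → V x y * Ω x y)
            ≈⟨ +-congʳ (trans (∑∑-+ n _ _) (+-congˡ (∑∑-*ˡ n κ _))) ⟩
          ∑∑ n (λ x y → e x y * Ω x y) + κ * ∑∑ n (λ x y → V x y * Ω x y) - κ * ∑∑ n (λ x y → V x y * Ω x y)
            ≈⟨ solve 2 (λ s t → (s :+ t :- t) := s) refl _ _ ⟩
          ∑∑ n (λ x y → e x y * Ω x y)
            ∎)
        where
        open ≤-Reasoning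
        below : ∀ {x y} → y ℕ.< x → 0# ≤ e x y * Ω x y + e y x * Ω y x
        below {x} {y} y<x = ≤-respʳ-≈
          (solve 4 (λ e e′ ω ω′ → (e :* (ω :- ω′) :+ (e :+ e′) :* ω′) := (e :* ω :+ e′ :* ω′)) refl
             (e x y) (e y x) (Ω x y) (Ω y x))
          (+-nonneg (*-nonneg (e-nonneg y<x) (0≤y-x (Ω-mono y<x))) (*-nonneg (e-sym x y) (0≤Ω y x)))
        eΩ-sym : ∀ x y → 0# ≤ e x y * Ω x y + e y x * Ω y x
        eΩ-sym x y with ℕ.<-cmp x y
        ... | tri< x<y _ _ = ≤-respʳ-≈ (+-comm _ _) (below x<y)
        ... | tri≈ _ ≡.refl _ = ≤-respʳ-≈
          (solve 2 (λ e ω → ((e :+ e) :* ω) := (e :* ω :+ e :* ω)) refl (e x x) (Ω x x))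
          (*-nonneg (e-sym x x) (0≤Ω x x))
        ... | tri> _ _ y<x = below y<x

  rearrange-zero : ∀ U {x y} → U x y ≈ 0# → U y x ≈ 0# → rearrange U x y ≈ 0#
  rearrange-zero U {x} {y} Uxy≈0 Uyx≈0 with ℕ.≤-<-connex y x
  ... | inj₁ y≤x rewrite rearrange-≤ U y≤x with ⊔-sel (U x y) (U y x)
  ...   | inj₁ ⊔≈ = trans ⊔≈ Uxy≈0
  ...   | inj₂ ⊔≈ = trans ⊔≈ Uyx≈0
  rearrange-zero U {x} {y} Uxy≈0 Uyx≈0 | inj₂ x<y rewrite rearrange-> U x<y with ⊓-sel (U x y) (U y x)
  ...   | inj₁ ⊓≈ = trans ⊓≈ Uxy≈0
  ...   | inj₂ ⊓≈ = trans ⊓≈ Uyx≈0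

  -- Above the diagonal the value is a minimum of nonnegative numbers, so one zero suffices; on the
  -- diagonal the two numbers coincide. This confines the support of the rearranged function.
  rearrange-zero-≤ : ∀ {U x y} → (∀ x y → 0# ≤ U x y) → x ℕ.≤ y → U x y ≈ 0# ⊎ U y x ≈ 0# → rearrange U x y ≈ 0#
  rearrange-zero-≤ {U} {x} {y} 0≤U x≤y U≈0 with ℕ.m≤n⇒m<n∨m≡n x≤y
  rearrange-zero-≤ {U} {x} {y} 0≤U x≤y (inj₁ U≈0) | inj₂ ≡.refl = rearrange-zero U U≈0 U≈0
  rearrange-zero-≤ {U} {x} {y} 0≤U x≤y (inj₂ U≈0) | inj₂ ≡.refl = rearrange-zero U U≈0 U≈0
  rearrange-zero-≤ {U} {x} {y} 0≤U x≤y U≈0 | inj₁ x<y = antisym (lemma U≈0) (rearrange-nonneg 0≤U x y)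
    where
    lemma : U x y ≈ 0# ⊎ U y x ≈ 0# → rearrange U x y ≤ 0#
    lemma U≈0 rewrite rearrange-> U x<y with U≈0
    ... | inj₁ Uxy≈0 = ≤-respʳ-≈ Uxy≈0 (x⊓y≤x _ _)
    ... | inj₂ Uyx≈0 = ≤-respʳ-≈ Uyx≈0 (x⊓y≤y _ _)

  -- Parity indicators.

  -- Recursion in steps of two gives both neighbours of a vertex the same value by computation, as
  -- `op-ε` uses.
  ε : ℕ → Carrier
  ε zero          = 1#
  ε (suc zero)    = 0#
  ε (suc (suc n)) = ε n

  ε-nonneg : ∀ n → 0# ≤ ε n
  ε-nonneg zero          = <⇒≤ 0<1
  ε-nonneg (suc zero)    = ≤-refl
  ε-nonneg (suc (suc n)) = ε-nonneg n

  ε-disjoint : ∀ n → ε n * ε (suc n) ≈ 0#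
  ε-disjoint zero          = zeroʳ 1#
  ε-disjoint (suc zero)    = zeroˡ 1#
  ε-disjoint (suc (suc n)) = ε-disjoint n

  -- The indicator of x ≡ y (mod 2).
  χ : ℕ → ℕ → Carrier
  χ x y = ε x * ε y + ε (suc x) * ε (suc y)

  χ-nonneg : ∀ x y → 0# ≤ χ x y
  χ-nonneg x y = +-nonneg (*-nonneg (ε-nonneg x) (ε-nonneg y)) (*-nonneg (ε-nonneg (suc x)) (ε-nonneg (suc y)))

  χ↑ : ∀ x → χ x (suc x) ≈ 0#
  χ↑ x = trans (+-cong (ε-disjoint x) (trans (*-comm _ _) (ε-disjoint x))) (+-identityˡ 0#)

  χ↓ : ∀ x → χ (suc x) x ≈ 0#
  χ↓ x = trans (+-cong (trans (*-comm _ _) (ε-disjoint x)) (ε-disjoint x)) (+-identityˡ 0#)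

  0<χ11 : 0# < χ 1 1
  0<χ11 = +-nonneg-pos (≤-reflexive (sym (zeroˡ 0#))) (*-pos 0<1 0<1)

  shift : (ℕ → Carrier) → ℕ → Carrier
  shift f zero    = 0#
  shift f (suc i) = f i

  -- Geometric weights and log-concavity of Perron vectors.

  module Geometric (s : Carrier) (0<s : 0# < s) where

    0≤s^ : ∀ i → 0# ≤ s ^ i
    0≤s^ = ^-nonneg (<⇒≤ 0<s)

    open Path (s ^_) 0≤s^ public

    -- Geometric weights are self-similar: deleting the first vertex multiplies every remaining
    -- weight by s. Hence the factor s in the Perron values of shifted subpaths.
    op-shift : ∀ f i → op (shift f) (suc i) ≈ s * op f i
    op-shift f zero    = solve 2 (λ s f → (s :* :1 :* f :+ :1 :* :0) := (s :* (:1 :* f))) refl s (f 1)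
    op-shift f (suc i) = solve 4 (λ s a f g → (s :* (s :* a) :* f :+ s :* a :* g) := (s :* (s :* a :* f :+ a :* g))) refl
      s (s ^ i) (f (2 ℕ.+ i)) (f i)

    -- Row i with its power of s extracted; `d-step` cancels this power.
    s*op : ∀ f i → s * op f i ≈ s ^ i * (s * f (suc i) + shift f i)
    s*op f zero    = solve 2 (λ s f → (s :* (:1 :* f)) := (:1 :* (s :* f :+ :0))) refl s (f 1)
    s*op f (suc i) = solve 4 (λ s a f g → (s :* (s :* a :* f :+ a :* g)) := (s :* a :* (s :* f :+ g))) refl
      s (s ^ i) (f (2 ℕ.+ i)) (f i)

    op-ε : ∀ f i → op (λ j → ε j * f j) i ≈ ε (suc i) * op f i
    op-ε f zero    = solve 3 (λ a e f → (a :* (e :* f)) := (e :* (a :* f))) refl (s ^ 0) (ε 1) (f 1)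
    op-ε f (suc i) = solve 5 (λ a b e f g → (a :* (e :* f) :+ b :* (e :* g)) := (e :* (a :* f :+ b :* g))) refl
      (s ^ suc i) (s ^ i) (ε i) (f (2 ℕ.+ i)) (f i)

    op-ε′ : ∀ f i → op (λ j → ε (suc j) * f j) i ≈ ε i * op f i
    op-ε′ f zero    = solve 3 (λ a e f → (a :* (e :* f)) := (e :* (a :* f))) refl (s ^ 0) (ε 0) (f 1)
    op-ε′ f (suc i) = solve 5 (λ a b e f g → (a :* (e :* f) :+ b :* (e :* g)) := (e :* (a :* f :+ b :* g))) refl
      (s ^ suc i) (s ^ i) (ε (suc i)) (f (2 ℕ.+ i)) (f i)

    -- `χ` is the sum of a both-even and a both-odd tensor product, and a simultaneous step
    -- exchanges the two.
    op₂-χ : ∀ f g x y → op₂ (λ x y → χ x y * (f x * g y)) x y ≈ χ x y * (op f x * op g y)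
    op₂-χ f g x y = begin-equality
      op₂ (λ x y → χ x y * (f x * g y)) x y
        ≈⟨ op₂-cong (λ x y → solve 6 (λ e e′ d d′ f g →
             ((e :* d :+ e′ :* d′) :* (f :* g)) := ((e :* f) :* (d :* g) :+ (e′ :* f) :* (d′ :* g))) refl
             (ε x) (ε (suc x)) (ε y) (ε (suc y)) (f x) (g y)) x y ⟩
      op₂ (λ x y → (ε x * f x) * (ε y * g y) + (ε (suc x) * f x) * (ε (suc y) * g y)) x y
        ≈⟨ op₂-+ _ _ x y ⟩
      op₂ (λ x y → (ε x * f x) * (ε y * g y)) x y + op₂ (λ x y → (ε (suc x) * f x) * (ε (suc y) * g y)) x y
        ≈⟨ +-cong (op₂-⊗ _ _ x y) (op₂-⊗ _ _ x y) ⟩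
      op (λ x → ε x * f x) x * op (λ y → ε y * g y) y + op (λ x → ε (suc x) * f x) x * op (λ y → ε (suc y) * g y) y
        ≈⟨ +-cong (*-cong (op-ε f x) (op-ε g y)) (*-cong (op-ε′ f x) (op-ε′ g y)) ⟩
      (ε (suc x) * op f x) * (ε (suc y) * op g y) + (ε x * op f x) * (ε y * op g y)
        ≈⟨ solve 6 (λ e e′ d d′ f g →
             ((e′ :* f) :* (d′ :* g) :+ (e :* f) :* (d :* g)) := ((e :* d :+ e′ :* d′) :* (f :* g))) refl
             (ε x) (ε (suc x)) (ε y) (ε (suc y)) (op f x) (op g y) ⟩
      χ x y * (op f x * op g y)
        ∎
      where open ≤-Reasoning

    -- A finite path is modelled by vectors on the infinite one that vanish from n on. The
    -- eigenvalue equation stops at n because `op z` may be positive just outside.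
    record Perron (n : ℕ) (ρ : Carrier) (z : ℕ → Carrier) : Set (c ⊔ ℓ₁ ⊔ ℓ₂) where
      field
        inside  : ∀ {i} → i ℕ.< n → 0# < z i
        outside : ∀ {i} → n ℕ.≤ i → z i ≈ 0#
        eigen   : ∀ {i} → i ℕ.< n → op z i ≈ ρ * z i

      nonneg : ∀ i → 0# ≤ z i
      nonneg i with ℕ.<-≤-connex i n
      ... | inj₁ i<n = <⇒≤ (inside i<n)
      ... | inj₂ n≤i = ≤-reflexive (sym (outside n≤i))

      -- Extension by zero turns the eigenvector into a subsolution everywhere: outside the path the
      -- left side is 0 and the right side is nonnegative.
      ρ*z≤op : ∀ i → ρ * z i ≤ op z i
      ρ*z≤op i with ℕ.<-≤-connex i n
      ... | inj₁ i<n = ≤-reflexive (sym (eigen i<n))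
      ... | inj₂ n≤i = ≤-respˡ-≈ (sym (trans (*-congˡ (outside n≤i)) (zeroʳ ρ))) (op-nonneg nonneg i)

      ρ-nonneg : 0 ℕ.< n → 0# ≤ ρ
      ρ-nonneg 0<n = *-cancelʳ-≤ (inside 0<n) (begin
        0# * z 0  ≈⟨ zeroˡ _ ⟩
        0#        ≤⟨ op-nonneg nonneg 0 ⟩
        op z 0    ≈⟨ eigen 0<n ⟩
        ρ * z 0   ∎)
        where open ≤-Reasoning

      ρ-pos : 1 ℕ.< n → 0# < ρ
      ρ-pos 1<n = ρ-nonneg 0<n , λ 0≈ρ → proj₂ (*-pos 0<1 (inside 1<n)) (begin-equality
        0#           ≈⟨ zeroˡ _ ⟨
        0# * z 0     ≈⟨ *-congʳ 0≈ρ ⟩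
        ρ * z 0      ≈⟨ eigen 0<n ⟨
        1# * z 1     ∎)
        where
        open ≤-Reasoning
        0<n = ℕ.<-trans (s≤s z≤n) 1<n

      -- Its nonnegativity is log-concavity of z at i, since `shift z i` is the entry before z i, or
      -- 0 at the start.
      d : ℕ → Carrier
      d i = z i * z i - shift z i * z (suc i)

      -- Row i multiplied by z(i+1) and row i+1 multiplied by z(i) have the same right side;
      -- equating the left sides eliminates ρ and gives `cross`. The last bracket is nonnegative, so
      -- d is monotone in a direction fixed by the sign of 1 - s.
      d-step : ∀ {i} → suc i ℕ.< n →
        s * d i ≈ s * d (suc i) + (1# - s) * (shift z i * z (suc i) + s * (z i * z (2 ℕ.+ i)))
      d-step {i} 1+i<n = begin-equality
        s * (z₀ * z₀ - w * z₁)
          ≈⟨ solve 5 (λ s w z₀ z₁ z₂ → (s :* (z₀ :* z₀ :- w :* z₁)) :=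
               ((s :* (s :* z₂ :+ z₀) :* z₀) :- s :* s :* (z₀ :* z₂) :- s :* w :* z₁)) refl s w z₀ z₁ z₂ ⟩
        s * (s * z₂ + z₀) * z₀ - s * s * (z₀ * z₂) - s * w * z₁
          ≈⟨ +-congʳ (+-congʳ cross) ⟨
        (s * z₁ + w) * z₁ - s * s * (z₀ * z₂) - s * w * z₁
          ≈⟨ solve 5 (λ s w z₀ z₁ z₂ →
               ((s :* z₁ :+ w) :* z₁ :- s :* s :* (z₀ :* z₂) :- s :* w :* z₁) :=
               (s :* (z₁ :* z₁ :- z₀ :* z₂) :+ (:1 :- s) :* (w :* z₁ :+ s :* (z₀ :* z₂)))) refl s w z₀ z₁ z₂ ⟩
        s * (z₁ * z₁ - z₀ * z₂) + (1# - s) * (w * z₁ + s * (z₀ * z₂))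
          ∎
        where
        open ≤-Reasoning
        w = shift z i
        z₀ = z i
        z₁ = z (suc i)
        z₂ = z (2 ℕ.+ i)
        scaled : s ^ i * ((s * z₁ + w) * z₁) ≈ s ^ i * (s * (s * z₂ + z₀) * z₀)
        scaled = begin-equality
          s ^ i * ((s * z₁ + w) * z₁)         ≈⟨ *-assoc _ _ _ ⟨
          s ^ i * (s * z₁ + w) * z₁           ≈⟨ *-congʳ (s*op z i) ⟨
          s * op z i * z₁                     ≈⟨ *-congʳ (*-congˡ (eigen (ℕ.<-trans (ℕ.n<1+n i) 1+i<n))) ⟩
          s * (ρ * z₀) * z₁                   ≈⟨ solve 4 (λ s ρ z₀ z₁ → (s :* (ρ :* z₀) :* z₁) := (s :* (ρ :* z₁) :* z₀)) refl s ρ z₀ z₁ ⟩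
          s * (ρ * z₁) * z₀                   ≈⟨ *-congʳ (*-congˡ (eigen 1+i<n)) ⟨
          s * op z (suc i) * z₀               ≈⟨ *-congʳ (s*op z (suc i)) ⟩
          s * s ^ i * (s * z₂ + z₀) * z₀      ≈⟨ solve 4 (λ s a y z → (s :* a :* y :* z) := (a :* (s :* y :* z))) refl s (s ^ i) (s * z₂ + z₀) z₀ ⟩
          s ^ i * (s * (s * z₂ + z₀) * z₀)    ∎
        cross : (s * z₁ + w) * z₁ ≈ s * (s * z₂ + z₀) * z₀
        cross = antisym (*-cancelˡ-≤ (^-pos 0<s i) (≤-reflexive scaled))
                        (*-cancelˡ-≤ (^-pos 0<s i) (≤-reflexive (sym scaled)))

      shift-nonneg : ∀ i → 0# ≤ shift z i
      shift-nonneg zero    = ≤-refl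
      shift-nonneg (suc i) = nonneg i

      d-last : ∀ {i} → n ℕ.≤ suc i → 0# ≤ d i
      d-last {i} n≤1+i = ≤-respʳ-≈ (begin-equality
        z i * z i                                ≈⟨ solve 2 (λ x y → x := (x :- y :* :0)) refl (z i * z i) (shift z i) ⟩
        z i * z i - shift z i * 0#               ≈⟨ +-congˡ (-‿cong (*-congˡ (outside n≤1+i))) ⟨
        d i                                      ∎)
        (²-nonneg (z i))
        where open ≤-Reasoning

      -- d is monotone, so its sign is decided at one end of [0 , n).
      d-nonneg : ∀ i → 0# ≤ d i
      d-nonneg with total s 1#
      ... | inj₁ s≤1 = λ i → descend i n (ℕ.m≤n+m n i)
        where
        -- The number k bounds the distance to the right end, where `d-last` applies, and drives the
        -- recursion towards larger i.
        descend : ∀ i k → n ℕ.≤ i ℕ.+ k → 0# ≤ d i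
        descend i zero    n≤ = d-last (ℕ.m≤n⇒m≤1+n (≡.subst (n ℕ.≤_) (ℕ.+-identityʳ i) n≤))
        descend i (suc k) n≤ with ℕ.≤-<-connex n (suc i)
        ... | inj₁ n≤1+i = d-last n≤1+i
        ... | inj₂ 1+i<n = ≤-trans (descend (suc i) k (≡.subst (n ℕ.≤_) (ℕ.+-suc i k) n≤))
          (*-cancelˡ-≤ 0<s (≤-respʳ-≈ (sym (d-step 1+i<n)) (≤-respˡ-≈ (+-identityʳ _)
            (+-mono-≤ ≤-refl (*-nonneg (0≤y-x s≤1) (+-nonneg (*-nonneg (shift-nonneg i) (nonneg _))
              (*-nonneg (<⇒≤ 0<s) (*-nonneg (nonneg i) (nonneg _)))))))))
      ... | inj₂ 1≤s = ascend
        where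
        ascend : ∀ i → 0# ≤ d i
        ascend zero = ≤-respʳ-≈ (solve 2 (λ x y → (x :* x) := (x :* x :- :0 :* y)) refl (z 0) (z 1)) (²-nonneg (z 0))
        ascend (suc i) with ℕ.≤-<-connex n (suc i)
        ... | inj₁ n≤1+i = d-last (ℕ.m≤n⇒m≤1+n n≤1+i)
        ... | inj₂ 1+i<n = ≤-trans (ascend i) (*-cancelˡ-≤ 0<s (≤-by
          (*-nonneg (0≤y-x 1≤s) (+-nonneg (*-nonneg (shift-nonneg i) (nonneg _))
            (*-nonneg (<⇒≤ 0<s) (*-nonneg (nonneg i) (nonneg _)))))
          (trans (+-congˡ (-‿cong (d-step 1+i<n)))
            (solve 3 (λ s x y → (x :- (x :+ (:1 :- s) :* y)) := ((s :- :1) :* y)) refl s _ _))))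

      -- Log-concavity makes z(x-1)/z(x) nondecreasing along the path. The product form also makes
      -- sense where z vanishes.
      shift-ratio : ∀ {x y} → y ℕ.≤ x → shift z y * z x ≤ shift z x * z y
      shift-ratio {x} {y} y≤x = go (ℕ.≤⇒≤′ y≤x)
        where
        go : ∀ {x} → y ℕ.≤′ x → shift z y * z x ≤ shift z x * z y
        go ℕ.≤′-refl = ≤-refl
        go {suc x} (ℕ.≤′-step y≤x) with ℕ.<-≤-connex x n
        ... | inj₂ n≤x = ≤-respˡ-≈ (sym (trans (*-congˡ (outside (ℕ.m≤n⇒m≤1+n n≤x))) (zeroʳ _)))
                           (*-nonneg (nonneg x) (nonneg y))
        ... | inj₁ x<n = *-cancelʳ-≤ (inside x<n) (begin
          shift z y * z (suc x) * z x       ≈⟨ solve 3 (λ p q r → (p :* q :* r) := (p :* r :* q)) refl _ _ _ ⟩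
          shift z y * z x * z (suc x)       ≤⟨ *-monoʳ-≤ (nonneg (suc x)) (go y≤x) ⟩
          shift z x * z y * z (suc x)       ≈⟨ solve 3 (λ p q r → (p :* q :* r) := (p :* r :* q)) refl _ _ _ ⟩
          shift z x * z (suc x) * z y       ≤⟨ *-monoʳ-≤ (nonneg y) (≤-by (d-nonneg x) refl) ⟩
          z x * z x * z y                   ≈⟨ solve 3 (λ p q r → (p :* q :* r) := (p :* r :* q)) refl _ _ _ ⟩
          z x * z y * z x                   ∎)
          where open ≤-Reasoning

  -- Log-concavity of the Perron values.

  module Product (s : Carrier) (0<s : 0# < s) where
    open Geometric s 0<s

    -- Writing ⟨ , ⟩ for the double sum, s μ κ ⟨V, Ω⟩ ≤ ⟨op₂ V, Ω⟩ = ⟨V, op₂ Ω⟩ = s p² ⟨V, Ω⟩, and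
    -- the positive factors ⟨V, Ω⟩ and s cancel.
    Perron-log-concave : ∀ {h μ p κ u z v} → 0 ℕ.< h →
      Perron h μ u → Perron (suc h) p z → Perron (2 ℕ.+ h) κ v → μ * κ ≤ p * p
    Perron-log-concave {h} {μ} {p} {κ} {u} {z} {v} 0<h pu pz pv =
      *-cancelˡ-≤ 0<s (begin
        s * (μ * κ)   ≈⟨ *-assoc _ _ _ ⟨
        s * μ * κ     ≤⟨ *-cancelʳ-≤ 0<S (begin
          s * μ * κ * S                       ≤⟨ rearrangement (s ^_) 0≤s^ 0≤U U↑ U↓ subsolution 0≤Ω Ω-mono n ⟩
          ∑∑ n (λ x y → op₂ V x y * Ω x y)    ≈⟨ op₂-symmetric n V Ω
                                                   (λ y → rearrange-zero U (Uny≈0 y) (Uxn≈0 y))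
                                                   (λ x → rearrange-zero U (Uxn≈0 x) (Uny≈0 x))
                                                   (λ y → trans (*-congʳ (Z.outside ℕ.≤-refl)) (zeroˡ _))
                                                   (λ x → trans (*-congˡ (Z.outside (ℕ.n≤1+n _))) (zeroʳ _)) ⟩
          ∑∑ n (λ x y → V x y * op₂ Ω x y)    ≈⟨ ∑-cong n (λ x x<n → ∑-cong n (λ y y<n → V-eigen x y x<n y<n)) ⟩
          ∑∑ n (λ x y → s * p * p * (V x y * Ω x y))
                                              ≈⟨ ∑∑-*ˡ n _ _ ⟩
          s * p * p * S                       ∎) ⟩
        s * p * p     ≈⟨ *-assoc _ _ _ ⟩
        s * (p * p)   ∎)
      where
      open ≤-Reasoning
      module U = Perron pu
      module Z = Perron pz
      module V = Perron pv
      n = 2 ℕ.+ h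
      U V Ω : ℕ → ℕ → Carrier
      U x y = χ x y * (shift u x * v y)
      V = rearrange U
      Ω x y = shift z x * z y
      S = ∑∑ n (λ x y → V x y * Ω x y)

      0≤U : ∀ x y → 0# ≤ U x y
      0≤U x y = *-nonneg (χ-nonneg x y) (*-nonneg (U.shift-nonneg x) (V.nonneg y))

      U↑ : ∀ x → U x (suc x) ≈ 0#
      U↑ x = trans (*-congʳ (χ↑ x)) (zeroˡ _)

      U↓ : ∀ x → U (suc x) x ≈ 0#
      U↓ x = trans (*-congʳ (χ↓ x)) (zeroˡ _)

      shift-subsolution : ∀ x → s * μ * shift u x ≤ op (shift u) x
      shift-subsolution zero    = ≤-respˡ-≈ (sym (zeroʳ _)) (op-nonneg U.shift-nonneg 0)
      shift-subsolution (suc x) = begin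
        s * μ * u x            ≈⟨ *-assoc _ _ _ ⟩
        s * (μ * u x)          ≤⟨ *-monoˡ-≤ (<⇒≤ 0<s) (U.ρ*z≤op x) ⟩
        s * op u x             ≈⟨ op-shift u x ⟨
        op (shift u) (suc x)   ∎

      subsolution : ∀ x y → s * μ * κ * U x y ≤ op₂ U x y
      subsolution x y = begin
        s * μ * κ * (χ x y * (shift u x * v y))        ≈⟨ solve 5 (λ m k c u v →
                                                            (m :* k :* (c :* (u :* v))) := (c :* (m :* u :* (k :* v)))) refl
                                                            (s * μ) κ (χ x y) (shift u x) (v y) ⟩
        χ x y * (s * μ * shift u x * (κ * v y))        ≤⟨ *-monoˡ-≤ (χ-nonneg x y) (*-mono-≤
                                                            (*-nonneg (*-nonneg (<⇒≤ 0<s) (U.ρ-nonneg 0<h)) (U.shift-nonneg x))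
                                                            (op-nonneg V.nonneg y) (shift-subsolution x) (V.ρ*z≤op y)) ⟩
        χ x y * (op (shift u) x * op v y)              ≈⟨ op₂-χ (shift u) v x y ⟨
        op₂ U x y                                      ∎

      0≤Ω : ∀ x y → 0# ≤ Ω x y
      0≤Ω x y = *-nonneg (Z.shift-nonneg x) (Z.nonneg y)

      Ω-mono : ∀ {x y} → y ℕ.< x → Ω y x ≤ Ω x y
      Ω-mono y<x = Z.shift-ratio (ℕ.<⇒≤ y<x)

      U0y≈0 : ∀ y → U 0 y ≈ 0#
      U0y≈0 y = trans (*-congˡ (zeroˡ _)) (zeroʳ _)

      Ux≈0 : ∀ {x} → suc h ℕ.≤ x → ∀ y → U x y ≈ 0#
      Ux≈0 (s≤s h≤x) y = trans (*-congˡ (trans (*-congʳ (U.outside h≤x)) (zeroˡ _))) (zeroʳ _)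

      Uny≈0 : ∀ y → U n y ≈ 0#
      Uny≈0 = Ux≈0 (ℕ.n≤1+n _)

      Uxn≈0 : ∀ x → U x n ≈ 0#
      Uxn≈0 x = trans (*-congˡ (trans (*-congˡ (V.outside ℕ.≤-refl)) (zeroʳ _))) (zeroʳ _)

      both-zero : ∀ x y α → V x y ≈ 0# → V x y * op₂ Ω x y ≈ α * (V x y * Ω x y)
      both-zero x y α V≈0 = trans (trans (*-congʳ V≈0) (zeroˡ _))
        (sym (trans (*-congˡ (trans (*-congʳ V≈0) (zeroˡ _))) (zeroʳ _)))

      -- The eigenvalue equation for `Ω` can fail in row 0 and in column h + 1. These positions lie
      -- on or above the diagonal, and one of the two values of `U` sorted there is outside the
      -- support of `shift u`, so `V` vanishes.
      V-eigen : ∀ x y → x ℕ.< n → y ℕ.< n → V x y * op₂ Ω x y ≈ s * p * p * (V x y * Ω x y)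
      V-eigen zero    y _ _ = both-zero 0 y _ (rearrange-zero-≤ 0≤U z≤n (inj₁ (U0y≈0 y)))
      V-eigen (suc x) y (s≤s x<1+h) (s≤s y≤1+h) with ℕ.m≤n⇒m<n∨m≡n y≤1+h
      ... | inj₂ ≡.refl = both-zero (suc x) y _ (rearrange-zero-≤ 0≤U x<1+h (inj₂ (Ux≈0 ℕ.≤-refl (suc x))))
      ... | inj₁ y<1+h = begin-equality
        V (suc x) y * op₂ Ω (suc x) y                 ≈⟨ *-congˡ (op₂-⊗ (shift z) z (suc x) y) ⟩
        V (suc x) y * (op (shift z) (suc x) * op z y) ≈⟨ *-congˡ (*-cong (trans (op-shift z x) (*-congˡ (Z.eigen x<1+h))) (Z.eigen y<1+h)) ⟩
        V (suc x) y * (s * (p * z x) * (p * z y))     ≈⟨ solve 5 (λ t s p z y →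
                                                           (t :* (s :* (p :* z) :* (p :* y))) := (s :* p :* p :* (t :* (z :* y)))) refl
                                                           (V (suc x) y) s p (z x) (z y) ⟩
        s * p * p * (V (suc x) y * Ω (suc x) y)       ∎

      VΩ-nonneg : ∀ x y → 0# ≤ V x y * Ω x y
      VΩ-nonneg x y = *-nonneg (rearrange-nonneg 0≤U x y) (0≤Ω x y)

      0<S : 0# < S
      -- At the diagonal pair (1, 1) the parities agree and the entries involved, u 0, v 1, z 0 and
      -- z 1, are all inside their paths; for u 0 and z 1 this is 0 < h.
      0<S = ∑-pos (λ x → ∑-nonneg n (VΩ-nonneg x)) {1} (s≤s (s≤s z≤n))
        (∑-pos (VΩ-nonneg 1) {1} (s≤s (s≤s z≤n))
          (*-pos (<-≤-trans (*-pos 0<χ11 (*-pos (U.inside 0<h) (V.inside (s≤s (s≤s z≤n))))) (x≤x⊔y _ _))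
                 (*-pos (Z.inside (s≤s z≤n)) (Z.inside (s≤s 0<h)))))

  -- Local Lipschitz continuity and suprema as roots.

  Bounded : Carrier → Carrier → Set ℓ₂
  Bounded L x = x ≤ L × - x ≤ L

  bounded-by-∣∣ : ∀ x → Bounded ∣ x ∣ x
  bounded-by-∣∣ x = x≤x⊔y _ _ , x≤y⊔x _ _

  bounded-nonneg : ∀ {L x} → Bounded L x → 0# ≤ L
  bounded-nonneg {L} {x} (x≤L , -x≤L) with total 0# x
  ... | inj₁ 0≤x = ≤-trans 0≤x x≤L
  ... | inj₂ x≤0 = ≤-trans (≤-by (0≤y-x x≤0) (solve 1 (λ x → (:- x :- :0) := (:0 :- x)) refl x)) -x≤L

  bounded-+ : ∀ {L M x y} → Bounded L x → Bounded M y → Bounded (L + M) (x + y)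
  bounded-+ {x = x} {y} (x≤L , -x≤L) (y≤M , -y≤M) = +-mono-≤ x≤L y≤M ,
    ≤-respˡ-≈ (solve 2 (λ x y → (:- x :+ :- y) := (:- (x :+ y))) refl x y) (+-mono-≤ -x≤L -y≤M)

  bounded-neg : ∀ {L x} → Bounded L x → Bounded L (- x)
  bounded-neg {x = x} (x≤L , -x≤L) = -x≤L , ≤-respˡ-≈ (solve 1 (λ x → x := (:- (:- x))) refl x) x≤L

  bounded-* : ∀ {L M x y} → Bounded L x → Bounded M y → Bounded (L * M) (x * y)
  bounded-* {L} {M} {x} {y} bx by =
    upper (proj₁ bx) (proj₂ bx) (proj₁ by) (proj₂ by) ,
    ≤-respˡ-≈ (solve 2 (λ x y → (:- x :* y) := (:- (x :* y))) refl x y)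
      (upper (proj₁ -bx) (proj₂ -bx) (proj₁ by) (proj₂ by))
    where
    -bx = bounded-neg bx
    upper : ∀ {x} → x ≤ L → - x ≤ L → y ≤ M → - y ≤ M → x * y ≤ L * M
    upper {x} x≤L -x≤L y≤M -y≤M with total 0# x
    ... | inj₁ 0≤x = *-mono-≤ 0≤x (bounded-nonneg by) x≤L y≤M
    ... | inj₂ x≤0 = ≤-respˡ-≈ (solve 2 (λ x y → (:- x :* :- y) := (x :* y)) refl x y)
      (*-mono-≤ (≤-by (0≤y-x x≤0) (solve 1 (λ x → (:- x :- :0) := (:0 :- x)) refl x)) (bounded-nonneg by) -x≤L -y≤M)

  -- f (x + d) = f x + d (q d) with q bounded near 0; a form of local
  -- Lipschitz continuity at x that is visibly stable under ring operations.
  record LipschitzAt (f : Carrier → Carrier) (x : Carrier) : Set (c ⊔ ℓ₁ ⊔ ℓ₂) where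
    constructor lipschitz
    field
      q         : Carrier → Carrier
      expansion : ∀ d → f (x + d) ≈ f x + d * q d
      L         : Carrier
      q-bounded : ∀ d → Bounded 1# d → Bounded L (q d)

  const-lipschitz : ∀ k x → LipschitzAt (λ _ → k) x
  const-lipschitz k x = lipschitz (λ _ → 0#)
    (λ d → solve 2 (λ k d → k := (k :+ d :* :0)) refl k d) ∣ 0# ∣ (λ _ _ → bounded-by-∣∣ 0#)

  id-lipschitz : ∀ x → LipschitzAt (λ t → t) x
  id-lipschitz x = lipschitz (λ _ → 1#)
    (λ d → solve 2 (λ x d → (x :+ d) := (x :+ d :* :1)) refl x d) ∣ 1# ∣ (λ _ _ → bounded-by-∣∣ 1#)

  minus-lipschitz : ∀ {f g x} → LipschitzAt f x → LipschitzAt g x → LipschitzAt (λ t → f t - g t) x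
  minus-lipschitz {f} {g} {x} (lipschitz q eqf L bq) (lipschitz p eqg M bp) = lipschitz (λ d → q d - p d)
    (λ d → trans (+-cong (eqf d) (-‿cong (eqg d))) (solve 5 (λ f g d q p →
      ((f :+ d :* q) :- (g :+ d :* p)) := (f :- g :+ d :* (q :- p))) refl (f x) (g x) d (q d) (p d)))
    (L + M) (λ d bd → bounded-+ (bq d bd) (bounded-neg (bp d bd)))

  *-lipschitz : ∀ {f g x} → LipschitzAt f x → LipschitzAt g x → LipschitzAt (λ t → f t * g t) x
  *-lipschitz {f} {g} {x} (lipschitz q eqf L bq) (lipschitz p eqg M bp) = lipschitz
    (λ d → q d * g x + f x * p d + d * (q d * p d))
    (λ d → trans (*-cong (eqf d) (eqg d)) (solve 5 (λ f g d q p →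
      ((f :+ d :* q) :* (g :+ d :* p)) := (f :* g :+ d :* (q :* g :+ f :* p :+ d :* (q :* p)))) refl (f x) (g x) d (q d) (p d)))
    (L * ∣ g x ∣ + ∣ f x ∣ * M + 1# * (L * M))
    (λ d bd → bounded-+
      (bounded-+ (bounded-* (bq d bd) (bounded-by-∣∣ (g x))) (bounded-* (bounded-by-∣∣ (f x)) (bp d bd)))
      (bounded-* bd (bounded-* (bq d bd) (bp d bd))))

  -- The radius is δ = f x / (∣L∣ + 1 + f x). The summand f x forces δ ≤ 1, so the bound on q
  -- applies, and ∣L∣ absorbs the variation: f (x + d) ≥ δ (1 + f x) > 0.
  stays-positive : ∀ {f x} → LipschitzAt f x → 0# < f x →
    ∃ λ δ → 0# < δ × (∀ d → Bounded δ d → 0# < f (x + d))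
  stays-positive {f} {x} (lipschitz q eq L bq) 0<fx = δ , 0<δ , positive
    where
    open ≤-Reasoning
    K = ∣ L ∣ + 1# + f x
    0≤∣L∣ = bounded-nonneg (bounded-by-∣∣ L)
    0<K : 0# < K
    0<K = +-nonneg-pos (+-nonneg 0≤∣L∣ (<⇒≤ 0<1)) 0<fx
    δ = f x * K ⁻¹
    0<δ : 0# < δ
    0<δ = *-pos 0<fx (⁻¹-pos 0<K)
    δK≈fx : δ * K ≈ f x
    δK≈fx = trans (*-assoc _ _ _) (trans (*-congˡ (*-inverseˡ (pos⇒≉0 0<K))) (*-identityʳ _))
    δ≤1 : δ ≤ 1#
    δ≤1 = *-cancelʳ-≤ 0<K (begin
      δ * K   ≈⟨ δK≈fx ⟩
      f x     ≤⟨ ≤-by (+-nonneg 0≤∣L∣ (<⇒≤ 0<1)) (solve 2 (λ l f → (:1 :* (l :+ :1 :+ f) :- f) := (l :+ :1)) refl ∣ L ∣ (f x)) ⟩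
      1# * K  ∎)
    positive : ∀ d → Bounded δ d → 0# < f (x + d)
    positive d (d≤δ , -d≤δ) = <-respʳ (sym (eq d)) (<-≤-trans (*-pos 0<δ (+-pos-nonneg 0<1 (<⇒≤ 0<fx)))
      (≤-by (+-nonneg (*-nonneg (<⇒≤ 0<δ) (0≤y-x (proj₁ (bounded-by-∣∣ L)))) (0≤y-x (proj₂ dq-bounded)))
        (trans (+-congʳ (+-congʳ (sym δK≈fx))) (solve 5 (λ δ L l f dq →
          ((δ :* (l :+ :1 :+ f) :+ dq) :- δ :* (:1 :+ f)) := (δ :* (l :- L) :+ (δ :* L :- :- dq))) refl
          δ L ∣ L ∣ (f x) (d * q d)))))
      where
      dq-bounded : Bounded (δ * L) (d * q d)
      dq-bounded = bounded-* (d≤δ , -d≤δ) (bq d (≤-trans d≤δ δ≤1 , ≤-trans -d≤δ δ≤1))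

  -- A form of the intermediate value theorem. If f x were positive, x - δ would still bound the
  -- sublevel set; if negative, x + δ would belong to it. It yields both square roots and
  -- eigenvalues.
  supremum-is-root : ∀ {p f x} {P : Carrier → Set p} →
    (∀ {s t} → s ≈ t → f s ≈ f t) → (∀ t → LipschitzAt f t) →
    (∀ {t} → P t → f t ≤ 0#) → (∀ {t} → f t ≤ 0# → P t) →
    IsSupremum P x → f x ≈ 0#
  supremum-is-root {f = f} {x} {P} f-cong f-lip P⇒ ⇒P (x-upper , x-least) = antisym f≤0 0≤f
    where
    f≤0 : f x ≤ 0#
    f≤0 with f x ≤? 0#
    ... | yes f≤0 = f≤0
    ... | no  f≰0 = contradiction (x-least x-δ-upper) (<⇒≱ x-δ<x)
      where
      positivity = stays-positive (f-lip x) (≰⇒> f≰0)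
      δ = proj₁ positivity
      0<δ = proj₁ (proj₂ positivity)
      x-δ<x : x - δ < x
      x-δ<x = <-by 0<δ (solve 2 (λ x δ → (x :- (x :- δ)) := δ) refl x δ)
      x-δ-upper : UpperBound P (x - δ)
      x-δ-upper {t} Pt with t ≤? (x - δ)
      ... | yes t≤x-δ = t≤x-δ
      ... | no  t≰x-δ = contradiction (P⇒ Pt) (<⇒≱ (<-respʳ (f-cong x+t-x≈t)
        (proj₂ (proj₂ positivity) (t - x) (t-x≤δ , x-t≤δ))))
        where
        x+t-x≈t : x + (t - x) ≈ t
        x+t-x≈t = solve 2 (λ x t → (x :+ (t :- x)) := t) refl x t
        t-x≤δ : t - x ≤ δ
        t-x≤δ = ≤-by (+-nonneg (0≤y-x (x-upper Pt)) (<⇒≤ 0<δ))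
                  (solve 3 (λ x t δ → (δ :- (t :- x)) := (x :- t :+ δ)) refl x t δ)
        x-t≤δ : - (t - x) ≤ δ
        x-t≤δ = ≤-by (0≤y-x (<⇒≤ (≰⇒> t≰x-δ)))
                  (solve 3 (λ x t δ → (δ :- :- (t :- x)) := (t :- (x :- δ))) refl x t δ)
    0≤f : 0# ≤ f x
    0≤f with 0# ≤? f x
    ... | yes 0≤f = 0≤f
    ... | no  0≰f = contradiction (x-upper (⇒P f[x+δ]≤0)) (<⇒≱ x<x+δ)
      where
      positivity = stays-positive (minus-lipschitz (const-lipschitz 0# x) (f-lip x)) (0<y-x (≰⇒> 0≰f))
      δ = proj₁ positivity
      0<δ = proj₁ (proj₂ positivity)
      -δ≤δ : - δ ≤ δ
      -δ≤δ = ≤-by (+-nonneg (<⇒≤ 0<δ) (<⇒≤ 0<δ)) (solve 1 (λ δ → (δ :- :- δ) := (δ :+ δ)) refl δ)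
      f[x+δ]≤0 : f (x + δ) ≤ 0#
      f[x+δ]≤0 = ≤-by (<⇒≤ (proj₂ (proj₂ positivity) δ (≤-refl , -δ≤δ))) refl
      x<x+δ : x < x + δ
      x<x+δ = <-by 0<δ (solve 2 (λ x δ → (x :+ δ :- x) := δ) refl x δ)

  -- Square roots.

  module _ {x : Carrier} (0≤x : 0# ≤ x) where
    private
      √-isSupremum : IsSupremum (λ y → Lift (c ⊔ ℓ₁ ⊔ ℓ₂) (y * y ≤ x)) (√ x)
      √-isSupremum = sup-isSupremum _ (0# , lift (≤-respˡ-≈ (sym (zeroˡ 0#)) 0≤x)) (x + 1# , λ (lift yy≤x) →
        ²-cancel-≤ (+-nonneg 0≤x (<⇒≤ 0<1)) (≤-trans yy≤x (≤-by
          (+-nonneg (+-nonneg (*-nonneg 0≤x 0≤x) 0≤x) (<⇒≤ 0<1))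
          (solve 1 (λ x → ((x :+ :1) :* (x :+ :1) :- x) := (x :* x :+ x :+ :1)) refl x))))

    √-nonneg : 0# ≤ √ x
    √-nonneg = proj₁ √-isSupremum (lift (≤-respˡ-≈ (sym (zeroˡ 0#)) 0≤x))

    √-square : √ x * √ x ≈ x
    √-square = trans (solve 2 (λ y x → (y :* y) := ((y :* y :- x) :+ x)) refl (√ x) x)
      (trans (+-congʳ (supremum-is-root {f = λ y → y * y - x}
        (λ s≈t → +-congʳ (*-cong s≈t s≈t))
        (λ t → minus-lipschitz (*-lipschitz (id-lipschitz t) (id-lipschitz t)) (const-lipschitz x t))
        (λ {t} (lift tt≤x) → ≤-by (0≤y-x tt≤x) (solve 2 (λ y x → (:0 :- (y :* y :- x)) := (x :- y :* y)) refl t x))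
        (λ {t} f≤0 → lift (≤-by (0≤y-x f≤0) (solve 2 (λ y x → (x :- y :* y) := (:0 :- (y :* y :- x))) refl t x)))
        √-isSupremum)) (+-identityˡ x))

  -- Existence of Perron vectors.

  module Existence (s : Carrier) (0<s : 0# < s) where
    open Geometric s 0<s

    -- The solution of the eigenvalue equation on the infinite path with initial value 1. Up to a
    -- positive factor φ n is the characteristic polynomial of the n × n matrix, and at a root the
    -- earlier values form an eigenvector.
    φ : ℕ → Carrier → Carrier
    φ zero          t = 1#
    φ (suc zero)    t = t
    φ (suc (suc n)) t = (s ^ suc n) ⁻¹ * (t * φ (suc n) t - s ^ n * φ n t)

    φ-cong : ∀ n {t u} → t ≈ u → φ n t ≈ φ n u
    φ-cong zero          t≈u = refl
    φ-cong (suc zero)    t≈u = t≈u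
    φ-cong (suc (suc n)) t≈u = *-congˡ (+-cong (*-cong t≈u (φ-cong (suc n) t≈u)) (-‿cong (*-congˡ (φ-cong n t≈u))))

    φ-lipschitz : ∀ n t → LipschitzAt (φ n) t
    φ-lipschitz zero          t = const-lipschitz 1# t
    φ-lipschitz (suc zero)    t = id-lipschitz t
    φ-lipschitz (suc (suc n)) t = *-lipschitz (const-lipschitz _ t)
      (minus-lipschitz (*-lipschitz (id-lipschitz t) (φ-lipschitz (suc n) t)) (*-lipschitz (const-lipschitz _ t) (φ-lipschitz n t)))

    φ-recurrence : ∀ n t → s ^ suc n * φ (2 ℕ.+ n) t ≈ t * φ (suc n) t - s ^ n * φ n t
    φ-recurrence n t = trans (sym (*-assoc _ _ _))
      (trans (*-congʳ (*-inverseʳ (pos⇒≉0 (^-pos 0<s (suc n))))) (*-identityˡ _))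

    φ-eigen : ∀ n t → op (λ i → φ i t) n ≈ t * φ n t
    φ-eigen zero    t = *-comm 1# t
    φ-eigen (suc n) t = trans (+-congʳ (φ-recurrence n t))
      (solve 2 (λ x y → (x :- y :+ y) := x) refl (t * φ (suc n) t) (s ^ n * φ n t))

    -- For a = s^n and b = s^(n+1) the recurrence reads b (φ(n+2) - φ(n+1)) = (t - a - b) φ(n+1) + a
    -- (φ(n+1) - φ(n)). Monotonicity is carried along to close the induction; the purpose is an
    -- upper bound for the roots.
    φ-eventually-increasing : ∀ n → ∃ λ C → ∀ t → C ≤ t → 0# < φ n t × φ n t ≤ φ (suc n) t
    φ-eventually-increasing zero    = 1# , λ t 1≤t → 0<1 , 1≤t
    φ-eventually-increasing (suc n) with φ-eventually-increasing n
    ... | C , increasing = C ⊔ᵣ (s ^ n + s ^ suc n) , λ t C⊔a≤t →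
      let 0<φ , φ≤φ′ = increasing t (≤-trans (x≤x⊔y _ _) C⊔a≤t)
          0<φ′ = <-≤-trans 0<φ φ≤φ′
      in 0<φ′ , *-cancelˡ-≤ (^-pos 0<s (suc n)) (≤-by
           (+-nonneg (*-nonneg (0≤y-x (≤-trans (x≤y⊔x _ _) C⊔a≤t)) (<⇒≤ 0<φ′)) (*-nonneg (0≤s^ n) (0≤y-x φ≤φ′)))
           (trans (+-congʳ (φ-recurrence n t)) (solve 5 (λ a b t x y →
             ((t :* y :- a :* x) :- b :* y) := ((t :- (a :+ b)) :* y :+ a :* (y :- x))) refl
             (s ^ n) (s ^ suc n) t (φ n t) (φ (suc n) t))))

    -- `at` makes the eigenvector at the root positive, and `above` lets the next, larger root
    -- inherit this positivity.
    record LargestRoot (n : ℕ) : Set (c ⊔ ℓ₁ ⊔ ℓ₂) where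
      field
        ρ     : Carrier
        root  : φ (suc n) ρ ≈ 0#
        at    : ∀ {i} → i ℕ.≤ n → 0# < φ i ρ
        above : ∀ {t} → ρ < t → ∀ {i} → i ℕ.≤ suc n → 0# < φ i t

    -- At the old root the recurrence leaves only -s^n φ(n), so the next polynomial is negative
    -- there. The supremum of its sublevel set is then a root strictly to the right, where all
    -- earlier polynomials are positive.
    largestRoot : ∀ n → LargestRoot n
    largestRoot zero = record
      { ρ     = 0#
      ; root  = refl
      ; at    = λ { z≤n → 0<1 }
      ; above = λ { 0<t z≤n → 0<1 ; 0<t (s≤s z≤n) → 0<t }
      }
    largestRoot (suc n) = record
      { ρ     = ρ′
      ; root  = root′
      ; at    = above ρ<ρ′
      ; above = above′
      }
      where
      open LargestRoot (largestRoot n)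
      P : Carrier → Set (c ⊔ ℓ₁ ⊔ ℓ₂)
      P t = Lift (c ⊔ ℓ₁ ⊔ ℓ₂) (φ (2 ℕ.+ n) t ≤ 0#)
      φρ<0 : φ (2 ℕ.+ n) ρ < 0#
      φρ<0 = <-by (*-pos (⁻¹-pos (^-pos 0<s (suc n))) (*-pos (^-pos 0<s n) (at ℕ.≤-refl)))
        (trans (+-congˡ (-‿cong (*-congˡ (+-congʳ (trans (*-congˡ root) (zeroʳ ρ))))))
          (solve 2 (λ b y → (:0 :- b :* (:0 :- y)) := (b :* y)) refl ((s ^ suc n) ⁻¹) (s ^ n * φ n ρ)))
      increasing = φ-eventually-increasing (suc n)
      P-bounded : UpperBound P (proj₁ increasing)
      P-bounded {t} (lift φt≤0) with t ≤? proj₁ increasing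
      ... | yes t≤C = t≤C
      ... | no  t≰C = contradiction φt≤0 (<⇒≱ (<-≤-trans (proj₁ φ-step) (proj₂ φ-step)))
        where φ-step = proj₂ increasing t (<⇒≤ (≰⇒> t≰C))
      ρ′ = sup P
      ρ′-sup : IsSupremum P ρ′
      ρ′-sup = sup-isSupremum P (ρ , lift (<⇒≤ φρ<0)) (proj₁ increasing , P-bounded)
      root′ : φ (2 ℕ.+ n) ρ′ ≈ 0#
      root′ = supremum-is-root (φ-cong (2 ℕ.+ n)) (φ-lipschitz (2 ℕ.+ n)) lower lift ρ′-sup
      ρ<ρ′ : ρ < ρ′
      ρ<ρ′ = proj₁ ρ′-sup (lift (<⇒≤ φρ<0)) , λ ρ≈ρ′ → proj₂ φρ<0 (trans (φ-cong (2 ℕ.+ n) ρ≈ρ′) root′)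
      above′ : ∀ {t} → ρ′ < t → ∀ {i} → i ℕ.≤ 2 ℕ.+ n → 0# < φ i t
      above′ {t} ρ′<t {i} i≤2+n with ℕ.m≤n⇒m<n∨m≡n i≤2+n
      ... | inj₁ (s≤s i≤1+n) = above (<-trans ρ<ρ′ ρ′<t) i≤1+n
      ... | inj₂ ≡.refl with φ (2 ℕ.+ n) t ≤? 0#
      ...   | yes φ≤0 = contradiction (proj₁ ρ′-sup (lift φ≤0)) (<⇒≱ ρ′<t)
      ...   | no  φ≰0 = ≰⇒> φ≰0

    truncate : ℕ → (ℕ → Carrier) → ℕ → Carrier
    truncate n f i = if i ℕ.<ᵇ n then f i else 0#

    truncate-< : ∀ {n} f {i} → i ℕ.< n → truncate n f i ≡ f i
    truncate-< {n} f {i} i<n with i ℕ.<ᵇ n | ℕ.<⇒<ᵇ i<n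
    ... | true | _ = ≡.refl

    truncate-≥ : ∀ {n} f {i} → n ℕ.≤ i → truncate n f i ≡ 0#
    truncate-≥ {n} f {i} n≤i with i ℕ.<ᵇ n | ℕ.<ᵇ⇒< i n
    ... | false | _   = ≡.refl
    ... | true  | i<n = contradiction (i<n _) (ℕ.≤⇒≯ n≤i)

    -- Only row n - 1 sees a removed entry, and that entry f n is zero already.
    op-truncate : ∀ {n f} → f n ≈ 0# → ∀ {i} → i ℕ.< n → op (truncate n f) i ≈ op f i
    op-truncate {n} {f} fn≈0 {i} i<n = op-local i agree
      where
      agree : ∀ {j} → Adjacent i j → truncate n f j ≈ f j
      agree {j} (inj₂ ≡.refl) = reflexive (truncate-< f (ℕ.<-trans (ℕ.n<1+n _) i<n))
      agree {j} (inj₁ ≡.refl) with ℕ.m≤n⇒m<n∨m≡n i<n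
      ... | inj₁ 1+i<n  = reflexive (truncate-< f 1+i<n)
      ... | inj₂ ≡.refl = trans (reflexive (truncate-≥ f (ℕ.≤-refl {n}))) (sym fn≈0)
      op-local : ∀ {f g} i → (∀ {j} → Adjacent i j → f j ≈ g j) → op f i ≈ op g i
      op-local i f≈g = antisym (op-mono i (λ i~j → ≤-reflexive (f≈g i~j))) (op-mono i (λ i~j → ≤-reflexive (sym (f≈g i~j))))

    perron-exists : ∀ n → ∃ λ ρ → ∃ (Perron (suc n) ρ)
    perron-exists n = ρ , truncate (suc n) φρ , record
      { inside  = λ {i} i<1+n → <-respʳ (reflexive (≡.sym (truncate-< φρ i<1+n))) (at (ℕ.s≤s⁻¹ i<1+n))
      ; outside = λ 1+n≤i → reflexive (truncate-≥ φρ 1+n≤i)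
      ; eigen   = λ {i} i<1+n → trans (op-truncate root i<1+n)
                    (trans (φ-eigen i ρ) (*-congˡ (reflexive (≡.sym (truncate-< φρ i<1+n)))))
      }
      where
      open LargestRoot (largestRoot n)
      φρ : ℕ → Carrier
      φρ i = φ i ρ

  -- The spectral radius of the matrices and its growth.

  extend : ∀ {n} → Vector Carrier n → ℕ → Carrier
  extend {n} u i with i ℕ.<? n
  ... | yes i<n = u (fromℕ< i<n)
  ... | no  _   = 0#

  extend-toℕ : ∀ {n} (u : Vector Carrier n) i → extend u (toℕ i) ≡ u i
  extend-toℕ {n} u i with toℕ i ℕ.<? n
  ... | yes i<n = ≡.cong u (Fin.fromℕ<-toℕ i i<n)
  ... | no  i≮n = contradiction (Fin.toℕ<n i) i≮n

  extend-≥ : ∀ {n} (u : Vector Carrier n) {i} → n ℕ.≤ i → extend u i ≡ 0#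
  extend-≥ {n} u {i} n≤i with i ℕ.<? n
  ... | yes i<n = contradiction n≤i (ℕ.<⇒≱ i<n)
  ... | no  _   = ≡.refl

  module Spectrum (r : Carrier) (0<r : 0# < r) where

    s : Carrier
    s = √ r

    0<s : 0# < s
    0<s = √-nonneg (<⇒≤ 0<r) , λ 0≈s → proj₂ 0<r (begin-equality
      0#       ≈⟨ zeroˡ s ⟨
      0# * s   ≈⟨ *-congʳ 0≈s ⟩
      s * s    ≈⟨ √-square (<⇒≤ 0<r) ⟩
      r        ∎)
      where open ≤-Reasoning

    open Geometric s 0<s
    open Existence s 0<s
    open Product s 0<s

    entry : ℕ → ℕ → Carrier
    entry i j = if suc i ≡ᵇ j then s ^ i else if suc j ≡ᵇ i then s ^ j else 0#

    -- The two tests exclude each other, so the nested conditional becomes a sum to which `∑-select`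
    -- applies termwise.
    entry-split : ∀ i j x → entry i j * x ≈
      (if suc i ≡ᵇ j then s ^ i * x else 0#) + (if suc j ≡ᵇ i then s ^ j * x else 0#)
    entry-split i j x with suc i ≡ᵇ j in eq₁ | suc j ≡ᵇ i in eq₂
    ... | true  | false = sym (+-identityʳ _)
    ... | false | true  = sym (+-identityˡ _)
    ... | false | false = trans (zeroˡ x) (sym (+-identityˡ 0#))
    ... | true  | true  = contradiction
      (≡.trans (≡.cong suc (ℕ.≡ᵇ⇒≡ (suc i) j (≡.subst Bool.T (≡.sym eq₁) _))) (ℕ.≡ᵇ⇒≡ (suc j) i (≡.subst Bool.T (≡.sym eq₂) _)))
      (λ 2+i≡i → ℕ.m≢1+n+m i {1} (≡.sym 2+i≡i))

    ∑-entry : ∀ n i f → (∀ {j} → n ℕ.≤ j → f j ≈ 0#) → i ℕ.< n → ∑ n (λ j → entry i j * f j) ≈ op f i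
    ∑-entry n i f f≈0 i<n = trans (∑-cong n (λ j _ → entry-split i j (f j))) (trans (∑-+ n _ _) (assemble i i<n))
      where
      assemble : ∀ i → i ℕ.< n →
        ∑ n (λ j → if suc i ≡ᵇ j then s ^ i * f j else 0#) + ∑ n (λ j → if suc j ≡ᵇ i then s ^ j * f j else 0#) ≈ op f i
      assemble i i<n with ∑-select n (suc i) (λ j → s ^ i * f j) (λ n≤1+i → trans (*-congˡ (f≈0 n≤1+i)) (zeroʳ _))
      assemble zero    i<n | upper = trans (+-cong upper (∑-0 n)) (+-identityʳ _)
      assemble (suc i) i<n | upper = +-cong upper (trans
        (∑-cong n (λ j _ → reflexive (≡.cong (λ b → if b then s ^ j * f j else 0#) (≡ᵇ-comm j i))))
        (∑-select n i (λ j → s ^ j * f j) (λ n≤i → contradiction i<n (ℕ.≤⇒≯ (ℕ.m≤n⇒m≤1+n n≤i)))))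
        where
        ≡ᵇ-comm : ∀ i j → (i ≡ᵇ j) ≡ (j ≡ᵇ i)
        ≡ᵇ-comm zero    zero    = ≡.refl
        ≡ᵇ-comm zero    (suc j) = ≡.refl
        ≡ᵇ-comm (suc i) zero    = ≡.refl
        ≡ᵇ-comm (suc i) (suc j) = ≡ᵇ-comm i j

    A-op : ∀ {n} (v : Vector Carrier n) f → (∀ i → v i ≈ f (toℕ i)) → (∀ {j} → n ℕ.≤ j → f j ≈ 0#) →
           ∀ i → (A n r ·ᵛ v) i ≈ op f (toℕ i)
    A-op {n} v f v≈f f≈0 i = trans
      (sum≈∑ (λ j → entry (toℕ i) j * f j) (λ j → *-congˡ (v≈f j)))
      (∑-entry n (toℕ i) f f≈0 (Fin.toℕ<n i))

    -- Cauchy-Schwarz over the at most two neighbours of i. The deficit is a multiple of (F (i+1) -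
    -- F (i-1))², and there is none at the end vertex.
    op-jensen : ∀ {z : ℕ → Carrier} → (∀ i → 0# ≤ z i) → ∀ (F : ℕ → Carrier) i →
      op (λ j → z j * F j) i * op (λ j → z j * F j) i ≤ op z i * op (λ j → z j * (F j * F j)) i
    op-jensen {z} 0≤z F zero = ≤-reflexive (solve 3 (λ a z f →
      (a :* (z :* f) :* (a :* (z :* f))) := (a :* z :* (a :* (z :* (f :* f))))) refl (s ^ 0) (z 1) (F 1))
    op-jensen {z} 0≤z F (suc i) = ≤-by
      (*-nonneg (*-nonneg (*-nonneg (0≤s^ (suc i)) (0≤s^ i)) (*-nonneg (0≤z (2 ℕ.+ i)) (0≤z i))) (²-nonneg (F (2 ℕ.+ i) - F i)))
      (solve 6 (λ a b y z f g →
        (((a :* y :+ b :* z) :* (a :* (y :* (f :* f)) :+ b :* (z :* (g :* g)))) :-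
         ((a :* (y :* f) :+ b :* (z :* g)) :* (a :* (y :* f) :+ b :* (z :* g)))) :=
        (a :* b :* (y :* z) :* ((f :- g) :* (f :- g)))) refl
        (s ^ suc i) (s ^ i) (z (2 ℕ.+ i)) (z i) (F (2 ℕ.+ i)) (F i))

    module _ {n : ℕ} {ρ : Carrier} {z : ℕ → Carrier} (0<n : 0 ℕ.< n) (perron : Perron n ρ z) where
      open Perron perron

      -- `F` and `H` stand for the real and imaginary parts of an eigenvector divided by z. The
      -- factors z j then serve as weights in `op-jensen`, with total `op z i` = ρ z i.
      module _ (F H : ℕ → Carrier) (a b : Carrier)
               (eigen-F : ∀ i → i ℕ.< n → op (λ j → z j * F j) i ≈ a * (z i * F i) - b * (z i * H i))
               (eigen-H : ∀ i → i ℕ.< n → op (λ j → z j * H j) i ≈ b * (z i * F i) + a * (z i * H i)) where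
        private
          F² H² G : ℕ → Carrier
          F² i = z i * (F i * F i)
          H² i = z i * (H i * H i)
          G i = F² i + H² i

          zG : ∀ i → z i * G i ≈ z i * F i * (z i * F i) + z i * H i * (z i * H i)
          zG i = solve 3 (λ z f h → (z :* (z :* (f :* f) :+ z :* (h :* h))) := (z :* f :* (z :* f) :+ z :* h :* (z :* h))) refl
            (z i) (F i) (H i)

          modulus : ∀ i → (a * a + b * b) * (z i * G i) ≈
            (a * (z i * F i) - b * (z i * H i)) * (a * (z i * F i) - b * (z i * H i)) +
            (b * (z i * F i) + a * (z i * H i)) * (b * (z i * F i) + a * (z i * H i))
          modulus i = trans (*-congˡ (zG i)) (solve 4 (λ a b u v → ((a :* a :+ b :* b) :* (u :* u :+ v :* v)) :=
                 ((a :* u :- b :* v) :* (a :* u :- b :* v) :+ (b :* u :+ a :* v) :* (b :* u :+ a :* v))) refl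
                 a b (z i * F i) (z i * H i))

          op-G : ∀ i → op z i * op F² i + op z i * op H² i ≈ op z i * op G i
          op-G i = trans (solve 3 (λ p q r → (p :* q :+ p :* r) := (p :* (q :+ r))) refl (op z i) (op F² i) (op H² i))
            (*-congˡ (sym (op-+ F² H² i)))

          -- Taking squared moduli in row i of the complex eigenvalue equation and applying
          -- Cauchy-Schwarz to both parts produces one factor ρ.
          pointwise : ∀ i → i ℕ.< n → (a * a + b * b) * (z i * G i) ≤ ρ * (z i * op G i)
          pointwise i i<n = begin
            (a * a + b * b) * (z i * G i)                   ≈⟨ modulus i ⟩
            _                                               ≈⟨ +-cong (*-cong (eigen-F i i<n) (eigen-F i i<n))
                                                                      (*-cong (eigen-H i i<n) (eigen-H i i<n)) ⟨
            op (λ j → z j * F j) i * op (λ j → z j * F j) i +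
            op (λ j → z j * H j) i * op (λ j → z j * H j) i ≤⟨ +-mono-≤ (op-jensen nonneg F i) (op-jensen nonneg H i) ⟩
            op z i * op F² i + op z i * op H² i             ≈⟨ op-G i ⟩
            op z i * op G i                                 ≈⟨ *-congʳ (eigen i<n) ⟩
            ρ * z i * op G i                                ≈⟨ *-assoc _ _ _ ⟩
            ρ * (z i * op G i)                              ∎
            where open ≤-Reasoning

          S : Carrier
          S = ∑ n (λ i → z i * G i)

          -- `S` is the squared norm of the eigenvector. Summing over the rows and moving `op` onto
          -- z by symmetry gives the second factor ρ.
          S-bound : (a * a + b * b) * S ≤ ρ * ρ * S
          S-bound = begin
            (a * a + b * b) * S                                ≈⟨ ∑-*ˡ n _ _ ⟨
            ∑ n (λ i → (a * a + b * b) * (z i * G i))    ≤⟨ ∑-mono-≤ n pointwise ⟩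
            ∑ n (λ i → ρ * (z i * op G i))               ≈⟨ ∑-*ˡ n ρ (λ i → z i * op G i) ⟩
            ρ * ∑ n (λ i → z i * op G i)                 ≈⟨ *-congˡ (op-symmetric n z G z-end G-end) ⟨
            ρ * ∑ n (λ i → op z i * G i)                 ≈⟨ *-congˡ (∑-cong n (λ i i<n →
                                                                    trans (*-congʳ (eigen i<n)) (*-assoc _ _ _))) ⟩
            ρ * ∑ n (λ i → ρ * (z i * G i))              ≈⟨ *-congˡ (∑-*ˡ n ρ (λ i → z i * G i)) ⟩
            ρ * (ρ * S)                                        ≈⟨ *-assoc ρ ρ S ⟨
            ρ * ρ * S                                          ∎
            where
            open ≤-Reasoning
            z-end : z n ≈ 0#
            z-end = outside ℕ.≤-refl
            G-end : G n ≈ 0#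
            G-end = trans (+-cong (trans (*-congʳ z-end) (zeroˡ _)) (trans (*-congʳ z-end) (zeroˡ _))) (+-identityˡ 0#)

        modulus-bound : ∀ {k} → k ℕ.< n → ¬ (z k * F k ≈ 0# × z k * H k ≈ 0#) → a * a + b * b ≤ ρ * ρ
        modulus-bound {k} k<n zF,zH≉0 = *-cancelʳ-≤ (∑-pos zG-nonneg k<n (<-respʳ (sym (zG k)) (²+²-pos zF,zH≉0))) S-bound
          where
          zG-nonneg : ∀ i → 0# ≤ z i * G i
          zG-nonneg i = ≤-respʳ-≈ (sym (zG i)) (+-nonneg (²-nonneg _) (²-nonneg _))

      -- Beyond n this contains an unspecified inverse of zero, but it is used only in products with
      -- z i, which vanish there.
      quotient : Vector Carrier n → ℕ → Carrier
      quotient w i = extend w i * z i ⁻¹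

      z*quotient-inside : ∀ w {i} → i ℕ.< n → z i * quotient w i ≈ extend w i
      z*quotient-inside w {i} i<n = begin-equality
        z i * (extend w i * z i ⁻¹)   ≈⟨ *-comm _ _ ⟩
        extend w i * z i ⁻¹ * z i     ≈⟨ *-assoc _ _ _ ⟩
        extend w i * (z i ⁻¹ * z i)   ≈⟨ *-congˡ (*-inverseˡ (pos⇒≉0 (inside i<n))) ⟩
        extend w i * 1#               ≈⟨ *-identityʳ _ ⟩
        extend w i                    ∎
        where open ≤-Reasoning

      z*quotient-outside : ∀ w {i} → n ℕ.≤ i → z i * quotient w i ≈ extend w i
      z*quotient-outside w {i} n≤i = begin-equality
        z i * quotient w i            ≈⟨ *-congʳ (outside n≤i) ⟩
        0# * quotient w i             ≈⟨ zeroˡ _ ⟩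
        0#                            ≡⟨ extend-≥ w n≤i ⟨
        extend w i                    ∎
        where open ≤-Reasoning

      z*quotient : ∀ w i → z i * quotient w i ≈ extend w i
      z*quotient w i = [ z*quotient-inside w , z*quotient-outside w ]′ (ℕ.<-≤-connex i n)

      quotient-fromℕ< : ∀ w {i} → (i<n : i ℕ.< n) → w (fromℕ< i<n) ≈ z i * quotient w i
      quotient-fromℕ< w {i} i<n = trans (sym (reflexive (extend-toℕ w (fromℕ< i<n))))
        (trans (reflexive (≡.cong (extend w) (Fin.toℕ-fromℕ< i<n))) (sym (z*quotient w i)))

      op-quotient : ∀ w {i} → (i<n : i ℕ.< n) →
        op (λ j → z j * quotient w j) i ≈ (A n r ·ᵛ w) (fromℕ< i<n)
      op-quotient w {i} i<n = trans (op-cong (z*quotient w) i) (sym (trans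
        (A-op w (extend w) (λ j → sym (reflexive (extend-toℕ w j))) (λ n≤j → reflexive (extend-≥ w n≤j)) (fromℕ< i<n))
        (reflexive (≡.cong (op (extend w)) (Fin.toℕ-fromℕ< i<n)))))

      eigenvalue-bound : ∀ {a b} → IsEigenvalue (A n r) a b → a * a + b * b ≤ ρ * ρ
      eigenvalue-bound {a} {b} (u , v , (k , uv≉0) , Au , Av) =
        modulus-bound (quotient u) (quotient v) a b
          (λ i i<n → trans (op-quotient u i<n) (trans (Au (fromℕ< i<n))
            (+-cong (*-congˡ (quotient-fromℕ< u i<n)) (-‿cong (*-congˡ (quotient-fromℕ< v i<n))))))
          (λ i i<n → trans (op-quotient v i<n) (trans (Av (fromℕ< i<n))
            (+-cong (*-congˡ (quotient-fromℕ< u i<n)) (*-congˡ (quotient-fromℕ< v i<n)))))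
          (Fin.toℕ<n k)
          (λ (zF≈0 , zH≈0) → uv≉0 (vanish u zF≈0 , vanish v zH≈0))
        where
        vanish : ∀ w → z (toℕ k) * quotient w (toℕ k) ≈ 0# → w k ≈ 0#
        vanish w eq = trans (sym (reflexive (extend-toℕ w k))) (trans (sym (z*quotient w (toℕ k))) eq)

      ρ-isEigenvalue : IsEigenvalue (A n r) ρ 0#
      ρ-isEigenvalue = z ∘ toℕ , (λ _ → 0#) , (fromℕ< 0<n , λ (z₀≈0 , _) → pos⇒≉0 (inside (Fin.toℕ<n (fromℕ< 0<n))) z₀≈0) ,
        (λ i → trans (A-op (z ∘ toℕ) z (λ _ → refl) outside i) (trans (eigen (Fin.toℕ<n i))
          (solve 1 (λ x → x := (x :- :0 :* :0)) refl (ρ * z (toℕ i))))) ,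
        (λ i → trans (A-op (λ _ → 0#) (λ _ → 0#) (λ _ → refl) (λ _ → refl) i) (trans (op-zero (λ _ → refl) (toℕ i))
          (solve 2 (λ x ρ → :0 := (:0 :* x :+ ρ :* :0)) refl (z (toℕ i)) ρ)))

      0≤ρ : 0# ≤ ρ
      0≤ρ = ρ-nonneg 0<n

      spectralRadius≈ρ : spectralRadius (A n r) ≈ ρ
      spectralRadius≈ρ = supremum-unique (sup-isSupremum _ (ρ , ρ∈) (ρ , upper)) (upper , λ u-upper → u-upper ρ∈)
        where
        Modulus : Carrier → Set (c ⊔ ℓ₁ ⊔ ℓ₂)
        Modulus x = Lift (c ⊔ ℓ₁ ⊔ ℓ₂) (∃₂ λ a b → IsEigenvalue (A n r) a b × x ≈ √ (a * a + b * b))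
        0≤a²+b² : ∀ a b → 0# ≤ a * a + b * b
        0≤a²+b² a b = +-nonneg (²-nonneg a) (²-nonneg b)
        ρ∈ : Modulus ρ
        ρ∈ = lift (ρ , 0# , ρ-isEigenvalue , ²-cancel-≈ 0≤ρ (√-nonneg (0≤a²+b² ρ 0#))
          (trans (solve 1 (λ ρ → (ρ :* ρ) := (ρ :* ρ :+ :0 :* :0)) refl ρ) (sym (√-square (0≤a²+b² ρ 0#)))))
        upper : UpperBound Modulus ρ
        upper (lift (a , b , ev , x≈√)) = ≤-respˡ-≈ (sym x≈√) (²-cancel-≤ 0≤ρ
          (≤-respˡ-≈ (sym (√-square (0≤a²+b² a b))) (eigenvalue-bound ev)))

      -- Pairing the eigenvalue equation with the all-ones vector bounds ρ by the largest row sum. A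
      -- row has at most two entries; as T dominates both 1 and s, each is at most T^n whether s is
      -- small or large.
      ρ-growth : ∀ {T} → 1# ≤ T → s ≤ T → ρ ≤ T ^ n + T ^ n
      ρ-growth {T} 1≤T s≤T = *-cancelʳ-≤ 0<S (begin
        ρ * S                                      ≈⟨ ∑-*ˡ n ρ z ⟨
        ∑ n (λ i → ρ * z i)                  ≈⟨ ∑-cong n (λ i i<n → trans (sym (eigen i<n))
                                                        (trans (sym (*-identityʳ _)) (*-congˡ (sym (reflexive (truncate-< _ i<n)))))) ⟩
        ∑ n (λ i → op z i * one i)           ≈⟨ op-symmetric n z one (outside ℕ.≤-refl) (reflexive (truncate-≥ {n} _ ℕ.≤-refl)) ⟩
        ∑ n (λ i → z i * op one i)           ≤⟨ ∑-mono-≤ n (λ i i<n → ≤-trans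
                                                        (*-monoˡ-≤ (nonneg i) (op-one i i<n)) (≤-reflexive (*-comm _ _))) ⟩
        ∑ n (λ i → (T ^ n + T ^ n) * z i)  ≈⟨ ∑-*ˡ n _ z ⟩
        (T ^ n + T ^ n) * S                ∎)
        where
        open ≤-Reasoning
        S = ∑ n z
        0<S : 0# < S
        0<S = ∑-pos nonneg {0} 0<n (inside 0<n)
        one : ℕ → Carrier
        one = truncate n (λ _ → 1#)
        one≤1 : ∀ i → one i ≤ 1#
        one≤1 i = [ (λ i<n → ≤-reflexive (reflexive (truncate-< _ i<n)))
                  , (λ n≤i → ≤-respˡ-≈ (sym (reflexive (truncate-≥ _ n≤i))) (<⇒≤ 0<1)) ]′ (ℕ.<-≤-connex i n)
        0≤T : 0# ≤ T
        0≤T = ≤-trans (<⇒≤ 0<1) 1≤T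
        s^i≤ : ∀ i → i ℕ.≤ n → s ^ i ≤ T ^ n
        s^i≤ i i≤n = ≤-trans (^-monoˡ-≤ (<⇒≤ 0<s) s≤T i) (^-monoʳ-≤ 1≤T i≤n)
        term : ∀ i j → i ℕ.≤ n → s ^ i * one j ≤ T ^ n
        term i j i≤n = ≤-trans (*-mono-≤ (0≤s^ i) (<⇒≤ 0<1) (s^i≤ i i≤n) (one≤1 j)) (≤-reflexive (*-identityʳ _))
        op-one : ∀ i → i ℕ.< n → op one i ≤ T ^ n + T ^ n
        op-one zero    i<n = ≤-trans (term 0 1 z≤n)
          (≤-by (^-nonneg 0≤T n) (solve 1 (λ t → (t :+ t :- t) := t) refl (T ^ n)))
        op-one (suc i) i<n = +-mono-≤ (term (suc i) (2 ℕ.+ i) (ℕ.<⇒≤ i<n)) (term i i (ℕ.≤-trans (ℕ.n≤1+n i) (ℕ.<⇒≤ i<n)))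

    private
      ρ : ℕ → Carrier
      ρ n = proj₁ (perron-exists n)

      perron : ∀ n → Perron (suc n) (ρ n) _
      perron n = proj₂ (proj₂ (perron-exists n))

      Λ≈ρ² : ∀ n → Λ (suc n) r ≈ ρ n * ρ n
      Λ≈ρ² n = trans (^-congˡ 2 (spectralRadius≈ρ (s≤s z≤n) (perron n))) (solve 1 (λ x → (x :* (x :* :1)) := (x :* x)) refl (ρ n))

    -- Two vertices are needed: the one-vertex matrix is zero.
    Λ-pos : ∀ n → 0# < Λ (2 ℕ.+ n) r
    Λ-pos n = <-respʳ (sym (Λ≈ρ² (suc n))) (*-pos 0<ρ 0<ρ)
      where 0<ρ = Perron.ρ-pos (perron (suc n)) (s≤s (s≤s z≤n))

    Λ-log-concave : ∀ n → Λ (suc n) r * Λ (3 ℕ.+ n) r ≤ Λ (2 ℕ.+ n) r * Λ (2 ℕ.+ n) r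
    Λ-log-concave n = begin
      Λ (suc n) r * Λ (3 ℕ.+ n) r                   ≈⟨ *-cong (Λ≈ρ² n) (Λ≈ρ² (2 ℕ.+ n)) ⟩
      (ρ n * ρ n) * (ρ (2 ℕ.+ n) * ρ (2 ℕ.+ n))     ≈⟨ solve 2 (λ x y → ((x :* x) :* (y :* y)) := ((x :* y) :* (x :* y))) refl (ρ n) (ρ (2 ℕ.+ n)) ⟩
      (ρ n * ρ (2 ℕ.+ n)) * (ρ n * ρ (2 ℕ.+ n))     ≤⟨ *-mono-≤ 0≤ρρ (²-nonneg (ρ (suc n))) concave concave ⟩
      (ρ (suc n) * ρ (suc n)) * (ρ (suc n) * ρ (suc n)) ≈⟨ *-cong (Λ≈ρ² (suc n)) (Λ≈ρ² (suc n)) ⟨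
      Λ (2 ℕ.+ n) r * Λ (2 ℕ.+ n) r                 ∎
      where
      open ≤-Reasoning
      0≤ρρ = *-nonneg (0≤ρ (s≤s z≤n) (perron n)) (0≤ρ (s≤s z≤n) (perron (2 ℕ.+ n)))
      concave = Perron-log-concave (s≤s z≤n) (perron n) (perron (suc n)) (perron (2 ℕ.+ n))

    Λ-growth : ∃ λ C → 0# ≤ C × ∀ n → Λ (suc n) r ≤ C * (1# ⊔ᵣ r) ^ n
    Λ-growth = C , 0≤C , bound
      where
      open ≤-Reasoning
      t = 1# ⊔ᵣ r
      T = √ t
      -- The square of the 2 from the row-sum bound, times the surplus factor t in T^(2(n+1)) = t
      -- t^n.
      C = (1# + 1#) * (1# + 1#) * t
      0≤t : 0# ≤ t
      0≤t = ≤-trans (<⇒≤ 0<1) (x≤x⊔y _ _)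
      0≤C : 0# ≤ C
      0≤C = *-nonneg (²-nonneg (1# + 1#)) 0≤t
      T²≈t : T * T ≈ t
      T²≈t = √-square 0≤t
      1≤T : 1# ≤ T
      1≤T = ²-cancel-≤ (√-nonneg 0≤t) (≤-respˡ-≈ (sym (*-identityˡ 1#)) (≤-respʳ-≈ (sym T²≈t) (x≤x⊔y _ _)))
      s≤T : s ≤ T
      s≤T = ²-cancel-≤ (√-nonneg 0≤t) (≤-respˡ-≈ (sym (√-square (<⇒≤ 0<r))) (≤-respʳ-≈ (sym T²≈t) (x≤y⊔x _ _)))
      bound : ∀ n → Λ (suc n) r ≤ C * t ^ n
      bound n = begin
        Λ (suc n) r                                           ≈⟨ Λ≈ρ² n ⟩
        ρ n * ρ n                                             ≤⟨ *-mono-≤ (0≤ρ (s≤s z≤n) (perron n)) (≤-trans (0≤ρ (s≤s z≤n) (perron n)) ρ≤) ρ≤ ρ≤ ⟩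
        (T ^ suc n + T ^ suc n) * (T ^ suc n + T ^ suc n)     ≈⟨ solve 1 (λ x → ((x :+ x) :* (x :+ x)) := ((:1 :+ :1) :* (:1 :+ :1) :* (x :* x))) refl (T ^ suc n) ⟩
        (1# + 1#) * (1# + 1#) * (T ^ suc n * T ^ suc n)       ≈⟨ *-congˡ (trans (sym (^-distrib-* T T (suc n))) (^-congˡ (suc n) T²≈t)) ⟩
        (1# + 1#) * (1# + 1#) * (t * t ^ n)                   ≈⟨ *-assoc _ _ _ ⟨
        C * t ^ n                                             ∎
        where ρ≤ = ρ-growth (s≤s z≤n) (perron n) 1≤T s≤T

  -- Least witnesses, monotone sequences and geometric decay.

  least : ∀ {p} {P : Pred ℕ p} → Decidable P → ∀ n → P n → ∃ λ m → P m × (∀ {k} → k ℕ.< m → ¬ P k)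
  least P? zero    Pn = zero , Pn , λ ()
  least {P = P} P? (suc n) Pn with P? zero
  ... | yes P0 = zero , P0 , λ ()
  ... | no ¬P0 with least (λ k → P? (suc k)) n Pn
  ...   | m , Pm , below = suc m , Pm , λ { {zero} _ → ¬P0 ; {suc k} (s≤s k<m) → below k<m }

  ascending : ∀ (f : ℕ → Carrier) {m n} → m ℕ.≤ n → (∀ k → m ℕ.≤ k → k ℕ.< n → f k ≤ f (suc k)) → f m ≤ f n
  ascending f {m} m≤n = go (ℕ.≤⇒≤′ m≤n)
    where
    go : ∀ {n} → m ℕ.≤′ n → (∀ k → m ℕ.≤ k → k ℕ.< n → f k ≤ f (suc k)) → f m ≤ f n
    go ℕ.≤′-refl          step = ≤-refl
    go (ℕ.≤′-step m≤′n) step = ≤-trans (go m≤′n (λ k m≤k k<n → step k m≤k (ℕ.m≤n⇒m≤1+n k<n)))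
      (step _ (ℕ.≤′⇒≤ m≤′n) ℕ.≤-refl)

  descending : ∀ (f : ℕ → Carrier) {m n} → m ℕ.≤ n → (∀ k → m ℕ.≤ k → k ℕ.< n → f (suc k) ≤ f k) → f n ≤ f m
  descending f {m} m≤n = go (ℕ.≤⇒≤′ m≤n)
    where
    go : ∀ {n} → m ℕ.≤′ n → (∀ k → m ℕ.≤ k → k ℕ.< n → f (suc k) ≤ f k) → f n ≤ f m
    go ℕ.≤′-refl          step = ≤-refl
    go (ℕ.≤′-step m≤′n) step = ≤-trans (step _ (ℕ.≤′⇒≤ m≤′n) ℕ.≤-refl)
      (go m≤′n (λ k m≤k k<n → step k m≤k (ℕ.m≤n⇒m≤1+n k<n)))

  -- A positive lower bound of all powers of x, divided by x, is again one, so
  -- the supremum u of the lower bounds satisfies u ≤ x u.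
  power-below : ∀ {x ε} → 0# < x → x < 1# → 0# < ε → ∃ λ N → x ^ N < ε
  power-below {x} {ε} 0<x x<1 0<ε with em {Lift (c ⊔ ℓ₁ ⊔ ℓ₂) (∃ λ N → x ^ N < ε)}
  ... | yes (lift found) = found
  ... | no  none = contradiction u≤xu (<⇒≱ xu<u)
    where
    LowerBound : Carrier → Set (c ⊔ ℓ₁ ⊔ ℓ₂)
    LowerBound y = Lift (c ⊔ ℓ₁ ⊔ ℓ₂) (∀ N → y ≤ x ^ N)
    u = sup LowerBound
    ε-lower : LowerBound ε
    ε-lower = lift λ N → ≮⇒≥ (λ x^N<ε → none (lift (N , x^N<ε)))
    u-sup : IsSupremum LowerBound u
    u-sup = sup-isSupremum LowerBound (ε , ε-lower) (1# , λ (lift y≤) → y≤ 0)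
    x⁻¹*x : ∀ y → x * (x ⁻¹ * y) ≈ y
    x⁻¹*x y = trans (sym (*-assoc _ _ _)) (trans (*-congʳ (*-inverseʳ (pos⇒≉0 0<x))) (*-identityˡ y))
    divided : ∀ {y} → LowerBound y → LowerBound (x ⁻¹ * y)
    divided {y} (lift y≤) = lift λ N → *-cancelˡ-≤ 0<x (≤-respˡ-≈ (sym (x⁻¹*x y)) (y≤ (suc N)))
    xu-upper : UpperBound LowerBound (x * u)
    xu-upper {y} y-lower = ≤-respˡ-≈ (x⁻¹*x y) (*-monoˡ-≤ (<⇒≤ 0<x) (proj₁ u-sup (divided y-lower)))
    u≤xu : u ≤ x * u
    u≤xu = proj₂ u-sup xu-upper
    xu<u : x * u < u
    xu<u = <-respʳ (*-identityˡ u) (*-monoʳ-< (<-≤-trans 0<ε (proj₁ u-sup ε-lower)) x<1)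

  geometric-bound⇒TendsToZero : ∀ {f : ℕ → Carrier} {x C} → 0# < x → x < 1# → 0# ≤ C →
    (∀ k → 0# ≤ f k) → (∀ k → f k ≤ C * x ^ k) → TendsToZero f
  geometric-bound⇒TendsToZero {f} {x} {C} 0<x x<1 0≤C 0≤f f≤ ε 0<ε = proj₁ small , λ k N≤k →
    ⊔-<-lub (below k N≤k) (-x<ε k)
    where
    open ≤-Reasoning
    -- C may be 0, so ε is divided by C + 1 instead.
    0<C+1 : 0# < C + 1#
    0<C+1 = +-nonneg-pos 0≤C 0<1
    small = power-below 0<x x<1 (*-pos 0<ε (⁻¹-pos 0<C+1))
    decreasing : ∀ k → x ^ suc k ≤ x ^ k
    decreasing k = ≤-respʳ-≈ (*-identityˡ _) (*-monoʳ-≤ (^-nonneg (<⇒≤ 0<x) k) (<⇒≤ x<1))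
    below : ∀ k → proj₁ small ℕ.≤ k → f k < ε
    below k N≤k = begin-strict
      f k                                ≤⟨ f≤ k ⟩
      C * x ^ k                          ≤⟨ *-monoʳ-≤ (^-nonneg (<⇒≤ 0<x) k) (≤-by (<⇒≤ 0<1) (solve 1 (λ C → (C :+ :1 :- C) := :1) refl C)) ⟩
      (C + 1#) * x ^ k                   ≤⟨ *-monoˡ-≤ (<⇒≤ 0<C+1) (descending (x ^_) N≤k (λ j _ _ → decreasing j)) ⟩
      (C + 1#) * x ^ proj₁ small         <⟨ *-monoˡ-< 0<C+1 (proj₂ small) ⟩
      (C + 1#) * (ε * (C + 1#) ⁻¹)       ≈⟨ solve 3 (λ p q r → (p :* (q :* r)) := (p :* r :* q)) refl (C + 1#) ε ((C + 1#) ⁻¹) ⟩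
      (C + 1#) * (C + 1#) ⁻¹ * ε         ≈⟨ *-congʳ (*-inverseʳ (pos⇒≉0 0<C+1)) ⟩
      1# * ε                             ≈⟨ *-identityˡ ε ⟩
      ε                                  ∎
    -x<ε : ∀ k → - f k < ε
    -x<ε k = ≤-<-trans (≤-by (0≤f k) (solve 1 (λ x → (:0 :- :- x) := x) refl (f k))) 0<ε
    ⊔-<-lub : ∀ {x y z} → x < z → y < z → x ⊔ᵣ y < z
    ⊔-<-lub {x} {y} x<z y<z with ⊔-sel x y
    ... | inj₁ ⊔≈x = ≤-<-trans (≤-reflexive ⊔≈x) x<z
    ... | inj₂ ⊔≈y = ≤-<-trans (≤-reflexive ⊔≈y) y<z

  -- Weighted log-concave sequences and their maximisers.

  module LogConcave (L : ℕ → Carrier) (L-pos : ∀ k → 1 ℕ.≤ k → 0# < L k)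
                    (L-concave : ∀ k → 1 ℕ.≤ k → L k * L (2 ℕ.+ k) ≤ L (suc k) * L (suc k)) where

    b : Carrier → ℕ → Carrier
    b σ k = σ ^ k * L k

    ratio : ℕ → Carrier
    ratio k = L k ÷ L (suc k)

    ratio-* : ∀ k → 1 ℕ.≤ k → ratio k * L (suc k) ≈ L k
    ratio-* k 1≤k = trans (*-assoc _ _ _)
      (trans (*-congˡ (*-inverseˡ (pos⇒≉0 (L-pos (suc k) (ℕ.m≤n⇒m≤1+n 1≤k))))) (*-identityʳ _))

    ratio-step : ∀ k → 1 ℕ.≤ k → ratio k ≤ ratio (suc k)
    ratio-step k 1≤k = *-cancelʳ-≤ (*-pos 0<L₁ 0<L₂) (begin
      ratio k * (L (suc k) * L (2 ℕ.+ k))          ≈⟨ *-assoc _ _ _ ⟨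
      ratio k * L (suc k) * L (2 ℕ.+ k)            ≈⟨ *-congʳ (ratio-* k 1≤k) ⟩
      L k * L (2 ℕ.+ k)                            ≤⟨ L-concave k 1≤k ⟩
      L (suc k) * L (suc k)                        ≈⟨ *-congʳ (ratio-* (suc k) (ℕ.m≤n⇒m≤1+n 1≤k)) ⟨
      ratio (suc k) * L (2 ℕ.+ k) * L (suc k)      ≈⟨ solve 3 (λ p q r → (p :* q :* r) := (p :* (r :* q))) refl _ _ _ ⟩
      ratio (suc k) * (L (suc k) * L (2 ℕ.+ k))    ∎)
      where
      open ≤-Reasoning
      0<L₁ = L-pos (suc k) (s≤s z≤n)
      0<L₂ = L-pos (2 ℕ.+ k) (s≤s z≤n)

    ratio-mono : ∀ {j k} → 1 ℕ.≤ j → j ℕ.≤ k → ratio j ≤ ratio k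
    ratio-mono 1≤j j≤k = ascending ratio j≤k (λ i j≤i _ → ratio-step i (ℕ.≤-trans 1≤j j≤i))

    -- Adjacent terms are `ratio k` and σ times one positive factor `w`, so comparing the terms is
    -- comparing these two numbers.
    module _ {σ : Carrier} (0<σ : 0# < σ) {k : ℕ} (1≤k : 1 ℕ.≤ k) where
      private
        w = σ ^ k * L (suc k)
        0<w : 0# < w
        0<w = *-pos (^-pos 0<σ k) (L-pos (suc k) (s≤s z≤n))
        b≈w*ratio : b σ k ≈ w * ratio k
        b≈w*ratio = trans (*-congˡ (sym (ratio-* k 1≤k)))
          (solve 3 (λ p q r → (p :* (q :* r)) := (p :* r :* q)) refl (σ ^ k) (ratio k) (L (suc k)))
        b′≈w*σ : b σ (suc k) ≈ w * σ
        b′≈w*σ = solve 3 (λ p q r → (p :* q :* r) := (q :* r :* p)) refl σ (σ ^ k) (L (suc k))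

      ratio≤σ⇒b≤b′ : ratio k ≤ σ → b σ k ≤ b σ (suc k)
      ratio≤σ⇒b≤b′ ratio≤σ = ≤-respˡ-≈ (sym b≈w*ratio) (≤-respʳ-≈ (sym b′≈w*σ) (*-monoˡ-≤ (<⇒≤ 0<w) ratio≤σ))

      σ≤ratio⇒b′≤b : σ ≤ ratio k → b σ (suc k) ≤ b σ k
      σ≤ratio⇒b′≤b σ≤ratio = ≤-respˡ-≈ (sym b′≈w*σ) (≤-respʳ-≈ (sym b≈w*ratio) (*-monoˡ-≤ (<⇒≤ 0<w) σ≤ratio))

      b≤b′⇒ratio≤σ : b σ k ≤ b σ (suc k) → ratio k ≤ σ
      b≤b′⇒ratio≤σ b≤b′ = *-cancelˡ-≤ 0<w (≤-respˡ-≈ b≈w*ratio (≤-respʳ-≈ b′≈w*σ b≤b′))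

      b′≤b⇒σ≤ratio : b σ (suc k) ≤ b σ k → σ ≤ ratio k
      b′≤b⇒σ≤ratio b′≤b = *-cancelˡ-≤ 0<w (≤-respˡ-≈ b′≈w*σ (≤-respʳ-≈ b≈w*ratio b′≤b))

    ratio-equality : ∀ k → 1 ℕ.≤ k → 0# < ratio k → b (ratio k) k ≈ b (ratio k) (suc k)
    ratio-equality k 1≤k 0<ratio = antisym (ratio≤σ⇒b≤b′ 0<ratio 1≤k ≤-refl) (σ≤ratio⇒b′≤b 0<ratio 1≤k ≤-refl)

    -- Monotone ratios extend the inequality at k to all later indices, so the sequence climbs up to
    -- k and descends from there.
    local⇒IsMaximiser : ∀ {σ} → 0# < σ → ∀ {k} → 1 ℕ.≤ k →
      σ ≤ ratio k → (∀ j → 1 ℕ.≤ j → j ℕ.< k → ratio j ≤ σ) → IsMaximiser (b σ) k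
    local⇒IsMaximiser {σ} 0<σ {k} 1≤k σ≤ratio ratio≤σ = 1≤k , λ j 1≤j → maximal j 1≤j (ℕ.≤-total j k)
      where
      maximal : ∀ j → 1 ℕ.≤ j → j ℕ.≤ k ⊎ k ℕ.≤ j → b σ j ≤ b σ k
      maximal j 1≤j (inj₁ j≤k) = ascending (b σ) j≤k λ i j≤i i<k →
        let 1≤i = ℕ.≤-trans 1≤j j≤i in ratio≤σ⇒b≤b′ 0<σ 1≤i (ratio≤σ i 1≤i i<k)
      maximal j 1≤j (inj₂ k≤j) = descending (b σ) k≤j λ i k≤i _ →
        σ≤ratio⇒b′≤b 0<σ (ℕ.≤-trans 1≤k k≤i) (≤-trans σ≤ratio (ratio-mono 1≤k k≤i))

    module _ {σ : Carrier} (0<σ : 0# < σ) where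

      IsMaximiser⇒σ≤ratio : ∀ {k} → IsMaximiser (b σ) k → σ ≤ ratio k
      IsMaximiser⇒σ≤ratio (1≤k , max) = b′≤b⇒σ≤ratio 0<σ 1≤k (max _ (s≤s z≤n))

      IsMaximiser⇒ratio≤σ : ∀ {k} → IsMaximiser (b σ) k → ∀ j → 1 ℕ.≤ j → j ℕ.< k → ratio j ≤ σ
      IsMaximiser⇒ratio≤σ {suc k} (_ , max) j 1≤j (s≤s j≤k) = ≤-trans (ratio-mono 1≤j j≤k)
        (b≤b′⇒ratio≤σ 0<σ 1≤k (max k 1≤k))
        where 1≤k = ℕ.≤-trans 1≤j j≤k

    -- No crossing value lies between σ and τ, so both satisfy the same
    -- inequalities σ ≤ ratio k and ratio j ≤ σ.
    IsMaximiser-constant : ∀ {p} {I : Pred Carrier p} → IsInterval I →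
      (∀ {σ} → I σ → 0# < σ) → (∀ {σ} → I σ → ¬ (∃ λ k → 1 ℕ.≤ k × b σ k ≈ b σ (suc k))) →
      ∀ {σ τ} → I σ → I τ → ∀ {k} → IsMaximiser (b σ) k → IsMaximiser (b τ) k
    IsMaximiser-constant {I = I} convex I-pos no-equality {σ} {τ} Iσ Iτ {k} max@(1≤k , _) =
      local⇒IsMaximiser (I-pos Iτ) 1≤k upper lower′
      where
      no-ratio : ∀ j → 1 ℕ.≤ j → ¬ I (ratio j)
      no-ratio j 1≤j I-ratio = no-equality I-ratio (j , 1≤j , ratio-equality j 1≤j (I-pos I-ratio))
      upper : τ ≤ ratio k
      upper with τ ≤? ratio k
      ... | yes τ≤ratio = τ≤ratio
      ... | no  τ≰ratio = contradiction
        (convex Iσ Iτ (IsMaximiser⇒σ≤ratio (I-pos Iσ) max) (<⇒≤ (≰⇒> τ≰ratio))) (no-ratio k 1≤k)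
      lower′ : ∀ j → 1 ℕ.≤ j → j ℕ.< k → ratio j ≤ τ
      lower′ j 1≤j j<k with ratio j ≤? τ
      ... | yes ratio≤τ = ratio≤τ
      ... | no  ratio≰τ = contradiction
        (convex Iτ Iσ (<⇒≤ (≰⇒> ratio≰τ)) (IsMaximiser⇒ratio≤σ (I-pos Iσ) max j 1≤j j<k)) (no-ratio j 1≤j)

    module _ {σ : Carrier} (0<σ : 0# < σ) (b→0 : TendsToZero (b σ)) where
      private
        0<b₁ : 0# < b σ 1
        0<b₁ = *-pos (^-pos 0<σ 1) (L-pos 1 ℕ.≤-refl)

        Beyond : ℕ → Set (ℓ₁ ⊔ ℓ₂)
        Beyond k = σ < ratio (suc k)

        -- If no ratio exceeded σ, the sequence would never fall below its positive first term and
        -- could not tend to zero.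
        beyond : ∃ Beyond
        beyond with em {Lift (c ⊔ ℓ₁ ⊔ ℓ₂) (∃ Beyond)}
        ... | yes (lift found) = found
        ... | no  none = contradiction b₁≤ (<⇒≱ (≤-<-trans (x≤x⊔y _ _) (proj₂ (b→0 _ 0<b₁) _ (ℕ.n≤1+n _))))
          where
          rising : ∀ k → 1 ℕ.≤ k → b σ k ≤ b σ (suc k)
          rising (suc k) 1≤k = ratio≤σ⇒b≤b′ 0<σ 1≤k (≮⇒≥ (λ σ<ratio → none (lift (k , σ<ratio))))
          b₁≤ : b σ 1 ≤ b σ (suc (proj₁ (b→0 _ 0<b₁)))
          b₁≤ = ascending (b σ) (s≤s z≤n) (λ k 1≤k _ → rising k 1≤k)

        -- The non-strict test locates the first maximiser and the strict one in `last` the final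
        -- maximiser. From the one up to just before the other the ratios equal σ, so the terms
        -- agree. The successor keeps indices at least 1.
        first : ∃ λ m → σ ≤ ratio (suc m) × (∀ {k} → k ℕ.< m → ¬ (σ ≤ ratio (suc k)))
        first = least (λ k → σ ≤? ratio (suc k)) (proj₁ beyond) (<⇒≤ (proj₂ beyond))

        last : ∃ λ m → Beyond m × (∀ {k} → k ℕ.< m → ¬ Beyond k)
        last = least (λ k → σ <? ratio (suc k)) (proj₁ beyond) (proj₂ beyond)

        m n : ℕ
        m = suc (proj₁ first)
        n = suc (proj₁ last)

        before-m : ∀ k → 1 ℕ.≤ k → k ℕ.< m → ratio k < σ
        before-m (suc k) _ (s≤s k<m) = ≰⇒> (proj₂ (proj₂ first) k<m)

        before-n : ∀ k → 1 ℕ.≤ k → k ℕ.< n → ratio k ≤ σ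
        before-n (suc k) _ (s≤s k<n) = ≮⇒≥ (proj₂ (proj₂ last) k<n)

        from-m : ∀ k → m ℕ.≤ k → σ ≤ ratio k
        from-m k m≤k = ≤-trans (proj₁ (proj₂ first)) (ratio-mono (s≤s z≤n) m≤k)

        between⇒IsMaximiser : ∀ {k} → m ℕ.≤ k → k ℕ.≤ n → IsMaximiser (b σ) k
        between⇒IsMaximiser {k} m≤k k≤n = local⇒IsMaximiser 0<σ (ℕ.≤-trans (s≤s z≤n) m≤k) (from-m k m≤k)
          (λ j 1≤j j<k → before-n j 1≤j (ℕ.<-≤-trans j<k k≤n))

        m≤n : m ℕ.≤ n
        m≤n with ℕ.≤-<-connex m n
        ... | inj₁ m≤n = m≤n
        ... | inj₂ n<m = contradiction (<⇒≤ (proj₁ (proj₂ last))) (<⇒≱ (before-m n (s≤s z≤n) n<m))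

        IsMaximiser⇒m≤ : ∀ {k} → IsMaximiser (b σ) k → m ℕ.≤ k
        IsMaximiser⇒m≤ {k} max with ℕ.≤-<-connex m k
        ... | inj₁ m≤k = m≤k
        ... | inj₂ k<m = contradiction (IsMaximiser⇒σ≤ratio 0<σ max) (<⇒≱ (before-m k (proj₁ max) k<m))

        IsMaximiser⇒≤n : ∀ {k} → IsMaximiser (b σ) k → k ℕ.≤ n
        IsMaximiser⇒≤n {k} max with ℕ.≤-<-connex k n
        ... | inj₁ k≤n = k≤n
        ... | inj₂ n<k = contradiction (IsMaximiser⇒ratio≤σ 0<σ max n (s≤s z≤n) n<k) (<⇒≱ (proj₁ (proj₂ last)))

      unimodal : Unimodal (b σ)
      unimodal = m , s≤s z≤n ,
        (λ k 1≤k k<m → ratio≤σ⇒b≤b′ 0<σ 1≤k (<⇒≤ (before-m k 1≤k k<m))) ,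
        (λ k m≤k → σ≤ratio⇒b′≤b 0<σ (ℕ.≤-trans (s≤s z≤n) m≤k) (from-m k m≤k))

      maximiser : ∃ (IsMaximiser (b σ))
      maximiser = m , between⇒IsMaximiser ℕ.≤-refl m≤n

      maximisers-interval : IsIntegerInterval (IsMaximiser (b σ))
      maximisers-interval = m , n , m≤n , λ k →
        mk⇔ (λ max → IsMaximiser⇒m≤ max , IsMaximiser⇒≤n max) (λ (m≤k , k≤n) → between⇒IsMaximiser m≤k k≤n)

  -- Application to the sequences of the theorem.

  module _ (r : Carrier) (0<r : 0# < r) where
    open Spectrum r 0<r using (Λ-pos; Λ-log-concave; Λ-growth)

    private
      L : ℕ → Carrier
      L k = Λ (k ℕ.+ 1) r

      L≡ : ∀ k → Λ (suc k) r ≡ L k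
      L≡ k = ≡.cong (λ h → Λ h r) (ℕ.+-comm 1 k)

      L-pos : ∀ k → 1 ℕ.≤ k → 0# < L k
      L-pos (suc k) _ = ≡.subst (0# <_) (L≡ (suc k)) (Λ-pos k)

      L-concave : ∀ k → 1 ℕ.≤ k → L k * L (2 ℕ.+ k) ≤ L (suc k) * L (suc k)
      L-concave k _ = ≡.subst₂ _≤_ (≡.cong₂ _*_ (L≡ k) (L≡ (2 ℕ.+ k))) (≡.cong₂ _*_ (L≡ (suc k)) (L≡ (suc k)))
        (Λ-log-concave k)

      L-nonneg : ∀ k → 0# ≤ L k
      -- Index 0 belongs to the one-vertex matrix and is not covered by `L-pos`, but the decay lemma
      -- asks for every k.
      L-nonneg zero    = ²-nonneg′ (spectralRadius (A 1 r))
        where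
        ²-nonneg′ : ∀ x → 0# ≤ x ^ 2
        ²-nonneg′ x = ≤-respʳ-≈ (*-congˡ (sym (*-identityʳ x))) (²-nonneg x)
      L-nonneg (suc k) = <⇒≤ (L-pos (suc k) (s≤s z≤n))

    open LogConcave L L-pos L-concave

    B→0 : ∀ {σ} → Admissible r σ → TendsToZero (λ k → B k σ r)
    B→0 {σ} (0<σ , σ<1⊓r⁻¹) = geometric-bound⇒TendsToZero (*-pos 0<σ 0<t) σt<1 (proj₁ (proj₂ Λ-growth))
      (λ k → *-nonneg (^-nonneg (<⇒≤ 0<σ) k) (L-nonneg k)) bound
      where
      open ≤-Reasoning
      C = proj₁ Λ-growth
      t = 1# ⊔ᵣ r
      0<t : 0# < t
      0<t = <-≤-trans 0<1 (x≤x⊔y 1# r)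
      -- The maximum of 1 and r is the reciprocal of the bound on σ; the two cases are the two
      -- values of the maximum.
      σt<1 : σ * t < 1#
      σt<1 = [ (λ t≈1 → begin-strict
                   σ * t        ≈⟨ *-congˡ t≈1 ⟩
                   σ * 1#       ≈⟨ *-identityʳ σ ⟩
                   σ            <⟨ σ<1⊓r⁻¹ ⟩
                   1# ⊓ r ⁻¹    ≤⟨ x⊓y≤x 1# (r ⁻¹) ⟩
                   1#           ∎)
             , (λ t≈r → begin-strict
                   σ * t        ≈⟨ *-congˡ t≈r ⟩
                   σ * r        <⟨ *-monoʳ-< 0<r (<-≤-trans σ<1⊓r⁻¹ (x⊓y≤y 1# (r ⁻¹))) ⟩
                   r ⁻¹ * r     ≈⟨ *-inverseˡ (pos⇒≉0 0<r) ⟩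
                   1#           ∎)
             ]′ (⊔-sel 1# r)
      bound : ∀ k → B k σ r ≤ C * (σ * t) ^ k
      bound k = begin
        σ ^ k * L k              ≡⟨ ≡.cong (σ ^ k *_) (L≡ k) ⟨
        σ ^ k * Λ (suc k) r      ≤⟨ *-monoˡ-≤ (^-nonneg (<⇒≤ 0<σ) k) (proj₂ (proj₂ Λ-growth) k) ⟩
        σ ^ k * (C * t ^ k)      ≈⟨ solve 3 (λ x y z → (x :* (y :* z)) := (y :* (x :* z))) refl (σ ^ k) C (t ^ k) ⟩
        C * (σ ^ k * t ^ k)      ≈⟨ *-congˡ (^-distrib-* σ t k) ⟨
        C * (σ * t) ^ k          ∎

    shape : ∀ σ → Admissible r σ →
      TendsToZero (λ k → B k σ r) × Unimodal (λ k → B k σ r) ×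
      (∃ λ k → IsMaximiser (λ j → B j σ r) k) × IsIntegerInterval (IsMaximiser (λ j → B j σ r))
    shape σ admissible@(0<σ , _) =
      B→0 admissible , unimodal 0<σ (B→0 admissible) , maximiser 0<σ (B→0 admissible) , maximisers-interval 0<σ (B→0 admissible)

    locally-constant : ∀ {p} (I : Pred Carrier p) → IsInterval I →
      (∀ {σ} → I σ → Admissible r σ) → (∀ {σ} → I σ → ¬ HasAdjacentEquality r σ) →
      ∀ {σ τ} → I σ → I τ → ∀ k → IsMaximiser (λ j → B j σ r) k ⇔ IsMaximiser (λ j → B j τ r) k
    locally-constant I convex admissible no-equality Iσ Iτ k = mk⇔ (transfer Iσ Iτ) (transfer Iτ Iσ)
      where
      transfer : ∀ {σ τ} → I σ → I τ → IsMaximiser (λ j → B j σ r) k → IsMaximiser (λ j → B j τ r) k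
      transfer Iσ Iτ = IsMaximiser-constant convex (λ Iσ → proj₁ (admissible Iσ)) no-equality Iσ Iτ

    crossing-mono : ∀ k → 1 ℕ.≤ k → crossing k r ≤ crossing (suc k) r
    crossing-mono k 1≤k = ≡.subst₂ _≤_ (ratio≡crossing k) (ratio≡crossing (suc k)) (ratio-step k 1≤k)
      where
      ratio≡crossing : ∀ k → ratio k ≡ crossing k r
      ratio≡crossing k = ≡.cong (λ h → Λ (k ℕ.+ 1) r ÷ Λ h r) (≡.sym (ℕ.+-suc k 1))

corollary7p4 : ∀ {c ℓ₁ ℓ₂ p} → ExcludedMiddle (c ⊔ ℓ₁ ⊔ ℓ₂) →
    (ℝ : CompleteOrderedField c ℓ₁ ℓ₂) → let open Reals ℝ in
    ∀ r → 0# < r →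
    (∀ σ → Admissible r σ →
    TendsToZero (λ k → B k σ r) ×
    Unimodal (λ k → B k σ r) ×
    (∃ λ k → IsMaximiser (λ j → B j σ r) k) ×
    IsIntegerInterval (IsMaximiser (λ j → B j σ r))) ×
    ((I : Pred Carrier p) → IsInterval I →
    (∀ {σ} → I σ → Admissible r σ) →
    (∀ {σ} → I σ → ¬ HasAdjacentEquality r σ) →
    ∀ {σ τ} → I σ → I τ →
    ∀ k → IsMaximiser (λ j → B j σ r) k ⇔ IsMaximiser (λ j → B j τ r) k) ×
    (∀ k → 1 ℕ.≤ k → crossing k r ≤ crossing (suc k) r)
corollary7p4 em ℝ r 0<r = shape r 0<r , locally-constant r 0<r , crossing-mono r 0<r
  where open RealAnalysis em ℝ
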